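{- Let $m,n$ be positive integers and $p\le\min\{m,n\}$ a nonnegative integer. Let $G(m,n,p)$ be the graph with vertex set $\{x_1,\dots,x_m\}\cup\{y_1,\dots,y_n\}$ and edge set $\{x_iy_j:1\le i\le m,1\le j\le n\}\setminus\{x_1y_1,\dots,x_py_p\}$, with unit resistance on each edge, and let $R_{uv}$ denote the effective resistance between vertices $u,v$. Write $[k]=\{1,\dots,k\}$ for $k\ge1$ and $[0]=\emptyset$. Then: (1) for $1\le i,j\le m$: $R_{x_ix_j}=\frac{2(m-1)}{mn-m-n}$ if $i\ne j$ and $i,j\in[p]$; $R_{x_ix_j}=\frac{2}{n}$ if $i\ne j$ and $i,j\in[m]\setminus[p]$; $R_{x_ix_j}=\frac{2n-1}{n(n-1)}+\frac{p-1}{p(n-1)(mn-m-n)}+\frac{n-p}{pn(n-1)(mn-m-n+p)}$ if $i\in[p]$, $j\in[m]\setminus[p]$. (2) for $1\le i,j\le n$: $R_{y_iy_j}=\frac{2(n-1)}{mn-m-n}$ if $i\ne j$ and $i,j\in[p]$; $R_{y_iy_j}=\frac{2}{m}$ if $i\ne j$ and $i,j\in[n]\setminus[p]$; $R_{y_iy_j}=\frac{2m-1}{m(m-1)}+\frac{p-1}{p(m-1)(mn-m-n)}+\frac{m-p}{pm(m-1)(mn-m-n+p)}$ if $i\in[p]$, $j\in[n]\setminus[p]$. (3) for $1\le i\le m$, $1\le j\le n$: $R_{x_iy_j}=\frac{m+n}{mn-m-n}-\frac{mn}{(mn-m-n)(mn-m-n+p)}$ if $i=j\in[p]$; $R_{x_iy_j}=\frac{m+n-2}{mn-m-n}-\frac{mn}{(mn-m-n)(mn-m-n+p)}$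 if $i\ne j$ and $i,j\in[p]$; $R_{x_iy_j}=\frac1m+\frac{(p-1)(m-1)}{p(mn-m-n)}+\frac{(m-p)(m-1)}{pm(mn-m-n+p)}$ if $i\in[p]$, $j\in[n]\setminus[p]$; $R_{x_iy_j}=\frac1n+\frac{(p-1)(n-1)}{p(mn-m-n)}+\frac{(n-p)(n-1)}{pn(mn-m-n+p)}$ if $i\in[m]\setminus[p]$, $j\in[p]$; $R_{x_iy_j}=\frac1m+\frac1n-\frac{mn-m-n}{mn(mn-m-n+p)}$ if $i\in[m]\setminus[p]$, $j\in[n]\setminus[p]$.
   Context: The effective resistance (resistance distance) $R_{uv}$ between vertices $u,v$ of a connected graph $G$ whose edges are resistors is the potential difference $U_{uv}$ divided by the current $I$ when a current $I$ is injected at $u$ and extracted at $v$ (currents and potentials obeying Ohm's law and Kirchhoff's laws). Equivalently, with unit resistances, $R_{uv}=\tau(G/\{u,v\})/\tau(G)$, where $\tau$ counts spanning trees and $G/\{u,v\}$ identifies $u$ and $v$ (deleting loops).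
   Formalization: G(m,n,p) is assumed connected, and every formula except 2/n and 2/m is stated only for mn ≠ m+n, i.e. not m=n=2, where terms become 0/0 (e.g. p=0); this also drops the one valid instance R_{x_2y_2}=1 for m=n=2, p=1. -}

module Defs where

open import Data.Nat as ℕ using (ℕ; zero; suc; _<ᵇ_; _≡ᵇ_)
open import Data.Integer using (+_)
open import Data.Bool using (Bool; not; _∧_; T)
open import Data.Fin as Fin using (Fin; toℕ; _↑ˡ_; _↑ʳ_; punchOut)
open import Data.Fin.Subset as Sub using (Subset)
open import Data.List as List using (List; []; _∷_; length; lookup; map; filter; concatMap; allFin)
open import Data.List.Membership.Propositional as LMem using ()
open import Data.List.Relation.Unary.Unique.Propositional using (Unique)
open import Data.Product using (Σ; ∃; _×_; _,_; proj₁; proj₂)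
open import Data.Sum using (_⊎_)
open import Data.Rational as ℚ using (ℚ; 0ℚ; _*_; 1/_; _/_)
import Data.Rational.Properties as ℚP
open import Relation.Binary.PropositionalEquality using (_≡_; _≢_; sym)
open import Relation.Nullary using (yes; no; ¬_)
open import Relation.Nullary.Decidable using (T?)

ℕ→ℚ : ℕ → ℚ
ℕ→ℚ k = (+ k) / 1

-- total division on ℚ (x ÷ 0 = 0).  In the theorem it is only ever
-- applied to denominators that are nonzero under the stated hypotheses.
infixl 7 _÷_
_÷_ : ℚ → ℚ → ℚ
x ÷ y with y ℚP.≟ 0ℚ
... | yes _ = 0ℚ
... | no y≢0 = x * (1/ y) {{ℚ.≢-nonZero y≢0}}

-- Finite multigraphs on vertex set Fin N: a list of (unordered) edges,
-- each given by its two endpoints.  Parallel edges allowed.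

Graph : ℕ → Set
Graph N = List (Fin N × Fin N)

EdgeIx : ∀ {N} → Graph N → Set
EdgeIx E = Fin (length E)

Joins : ∀ {N} → Fin N × Fin N → Fin N → Fin N → Set
Joins (a , b) u w = (a ≡ u × b ≡ w) ⊎ (a ≡ w × b ≡ u)

data Walk {N} (E : Graph N) (S : Subset (length E)) : Fin N → Fin N → List (EdgeIx E) → Set where
  [] : ∀ {u} → Walk E S u u []
  step : ∀ {u w v es} (e : EdgeIx E) → e Sub.∈ S → Joins (lookup E e) u w →
         Walk E S w v es → Walk E S u v (e ∷ es)

ConnectedOn : ∀ {N} (E : Graph N) → Subset (length E) → Set
ConnectedOn E S = ∀ u v → ∃ λ es → Walk E S u v es

AcyclicOn : ∀ {N} (E : Graph N) → Subset (length E) → Set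
AcyclicOn E S = ∀ u es → Walk E S u u es → Unique es → es ≡ []

SpanningTree : ∀ {N} (E : Graph N) → Subset (length E) → Set
SpanningTree E S = ConnectedOn E S × AcyclicOn E S

Connected : ∀ {N} → Graph N → Set
Connected E = ConnectedOn E Sub.⊤

HasCount : ∀ {k} → (Subset k → Set) → ℕ → Set
HasCount {k} P t =
  Σ (List (Subset k)) λ L → Unique L × length L ≡ t ×
    (∀ S → S LMem.∈ L → P S) × (∀ S → P S → S LMem.∈ L)

NumSpanningTrees : ∀ {N} → Graph N → ℕ → Set
NumSpanningTrees E t = HasCount (SpanningTree E) t

-- Contraction G/{u,v} (u ≢ v): v is identified with u, the vertex v is
-- removed (vertices renumbered by punchOut), loops are deleted,
-- parallel edges are kept.

contractVertex : ∀ {N} (u v : Fin (suc N)) → u ≢ v → Fin (suc N) → Fin N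
contractVertex u v u≢v w with w Fin.≟ v
... | yes _ = punchOut {i = v} {j = u} (λ eq → u≢v (sym eq))
... | no w≢v = punchOut {i = v} {j = w} (λ eq → w≢v (sym eq))

notLoop : ∀ {N} → Fin N × Fin N → Bool
notLoop (a , b) = not (toℕ a ≡ᵇ toℕ b)

contract : ∀ {N} (E : Graph (suc N)) (u v : Fin (suc N)) → u ≢ v → Graph N
contract E u v h =
  List.filterᵇ notLoop (map (λ { (a , b) → (contractVertex u v h a , contractVertex u v h b) }) E)

-- Effective resistance: R_uv = τ(G/{u,v}) / τ(G)  (and R_uu = 0).
-- ResistanceIs E u v r  :  the effective resistance between u and v is r.

ResistanceIs : ∀ {N} → Graph N → Fin N → Fin N → ℚ → Set
ResistanceIs {zero} E () v r
ResistanceIs {suc N} E u v r with u Fin.≟ v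
... | yes _ = r ≡ 0ℚ
... | no u≢v = Σ ℕ λ a → Σ ℕ λ b →
      NumSpanningTrees (contract E u v u≢v) a × NumSpanningTrees E b × r ≡ ℕ→ℚ a ÷ ℕ→ℚ b

-- The graph G(m,n,p): vertices x_1..x_m, y_1..y_n, encoded as
-- x_i = (i-1) ↑ˡ n  and  y_j = m ↑ʳ (j-1)  in Fin (m + n);
-- edges x_i y_j for all i, j except x_k y_k with k ≤ p.

xv : ∀ {m} n → Fin m → Fin (m ℕ.+ n)
xv n i = i ↑ˡ n

yv : ∀ m {n} → Fin n → Fin (m ℕ.+ n)
yv m j = m ↑ʳ j

keepEdge : ∀ {m n} (p : ℕ) → Fin m → Fin n → Bool
keepEdge p i j = not ((toℕ i ≡ᵇ toℕ j) ∧ (toℕ i <ᵇ p))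

Gmnp : (m n p : ℕ) → Graph (m ℕ.+ n)
Gmnp m n p =
  concatMap (λ i → map (λ j → (xv n i , yv m j))
                       (List.filterᵇ (keepEdge p i) (allFin n)))
            (allFin m)

{-# OPTIONS --safe #-}
-- Let ρ(a,b) be the number of spanning trees of G after identifying a and b, and t the number
-- of spanning trees of G. For w ≠ v, Σ_{z ~ w} (ρ(w,z) + ρ(w,v) − ρ(z,v)) = 2t: the summand is
-- twice the number of two-component spanning forests separating w from {z, v}, and adding the
-- edge w z to such a forest gives each spanning tree exactly once. Spanning trees are counted by
-- deletion–contraction, in any order of the edges; if the edges at w come last, the identity
-- reduces to the case of a star, where the count is a product. It follows that
-- g(z) = ρ(z,v) − ρ(z,u) has Laplacian 2t (δ_u − δ_v) and g(u) − g(v) = 2 ρ(u,v), so the resistance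
-- ρ(u,v)/t is the potential drop from u to v per unit of current.
--
-- In G(m,n,p) the Laplacian equations at x_k, y_k (k ≤ p) form a 2×2 system of determinant
-- D = mn − m − n once the sums X, Y of the potentials over the two sides are known, and summing
-- the equations gives (D + p)(nX − mY).
module Submission where

open import Defs
open import Data.Bool as Bool using (Bool; true; false; not; _∧_)
open import Data.Empty using (⊥-elim)
open import Data.Fin as Fin using (Fin; zero; suc; toℕ; fromℕ<; punchIn)
open import Data.Fin.Properties using (all?; punchInᵢ≢i; punchOut-injective; punchOut-punchIn; punchOut-cong; suc-injective; toℕ-injective; toℕ<n; toℕ-fromℕ<; splitAt-↑ˡ; splitAt-↑ʳ; ↑ˡ-injective; ↑ʳ-injective)
open import Data.Fin.Subset as Sub using (Subset; inside; outside)
open import Data.Integer as ℤ using ()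
import Data.Integer.Properties as ℤP
open import Data.List using (List; []; _∷_; _++_; map; concatMap; length; lookup; tabulate; allFin; filterᵇ)
open import Data.List.Properties using (length-++; length-map; ++-identityʳ)
open import Data.List.Membership.Propositional using (_∈_; find)
open import Data.List.Membership.Propositional.Properties using (∈-map⁺; ∈-map⁻; ∈-++⁺ˡ; ∈-++⁺ʳ; ∈-++⁻; ∈-concatMap⁻; ∈-filter⁻; ∈-lookup)
import Data.List.Membership.DecPropositional as DecMembership
open import Data.List.Relation.Binary.Permutation.Propositional using (_↭_; prep; swap; ↭-sym)
open import Data.List.Relation.Binary.Permutation.Propositional.Properties using (shift)
open import Data.List.Relation.Unary.All as All using (All; []; _∷_)
open import Data.List.Relation.Unary.AllPairs using ([]; _∷_)
open import Data.List.Relation.Unary.Any using (here; there)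
open import Data.List.Relation.Unary.Unique.Propositional using (Unique)
import Data.List.Relation.Unary.Unique.Propositional.Properties as Unique
open import Data.Nat using (ℕ; _≤_; _<_)
open import Data.Nat as ℕ using (zero; suc; _<ᵇ_; _≡ᵇ_; z≤n; s≤s)
import Data.Nat.Properties as ℕP
import Data.Nat.Tactic.RingSolver as ℕSolver
open import Data.Product using (∃; ∃₂; _×_; _,_; proj₁; proj₂)
open import Data.Rational using (ℚ; _+_; _-_; _*_; 0ℚ; 1ℚ; -_; 1/_; ≢-nonZero; toℚᵘ)
import Data.Rational.Properties as ℚP
import Data.Rational.Unnormalised as ℚᵘ
import Data.Rational.Unnormalised.Properties as ℚᵘP
open import Data.Sum using (_⊎_; inj₁; inj₂)
open import Data.Unit using (⊤; tt)
open import Data.Vec.Base using ([]; _∷_; here; there)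
open import Data.Vec.Properties using (∷-injectiveʳ)
open import Function using (_∘_; id; mk⇔)
open import Level using (0ℓ)
open import Relation.Nullary using (¬_; Dec; yes; no)
open import Relation.Nullary.Decidable using (does; does-⇔; dec-true; dec-false; dec⇒maybe; T?)
open import Relation.Binary.PropositionalEquality
open import Algebra.Properties.CommutativeSemigroup ℕP.+-commutativeSemigroup using (interchange)
open import Algebra.Properties.Group ℚP.+-0-group using (x∙y⁻¹≈ε⇒x≈y)
open import Tactic.RingSolver using (solve-∀)
open import Tactic.RingSolver.Core.AlmostCommutativeRing using (AlmostCommutativeRing; fromCommutativeRing)

-- The forest count in the overview has the following reason. `ρ(w,z)` counts the two-component
-- spanning forests that separate w from z, and v lies on one of the two sides. Writing F(w|zv) for
-- the forests with v on the side of z, one has ρ(w,z) = F(w|zv) + F(wv|z), and the same splitting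
-- of ρ(w,v) and ρ(z,v) leaves ρ(w,z) + ρ(w,v) - ρ(z,v) = 2F(w|zv). Conversely, the path from w to v
-- in a spanning tree starts with exactly one edge at w, and deleting that edge gives back the
-- forest. Formally these forests appear only as combinations of tree counts, so that
-- deletion-contraction acts on every term in the same way. Identifying vertices is recorded by a
-- labelling of the vertices, while the edge list keeps its endpoints; the tree count depends only
-- on which labels are equal. On the electrical side the drop is derived for an arbitrary solution
-- of the Laplacian equations and any current c, and then evaluated at the one solution g that the
-- tree counts supply. The equations are solved in multiplied-out form, and the denominators are
-- cleared only when they are compared with the stated formulas.

private
  variable
    V K K′ : ℕ

-- Vertex partitions given by labellings

Labelling : ℕ → ℕ → Set
Labelling V K = Fin V → Fin K

infix 4 _⊑_ _≋_

-- A labelling stands for the partition into its fibres, and `ℓ′` is the coarser partition here. The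
-- numbers of labels may differ, which allows a comparison between a contracted vertex set and the
-- original one.
_⊑_ : Labelling V K → Labelling V K′ → Set
ℓ ⊑ ℓ′ = ∀ {x y} → ℓ x ≡ ℓ y → ℓ′ x ≡ ℓ′ y

_≋_ : Labelling V K → Labelling V K′ → Set
ℓ ≋ ℓ′ = (ℓ ⊑ ℓ′) × (ℓ′ ⊑ ℓ)

-- The label of `b` falls out of use but `K` stays the same, so a single remaining class shows as
-- `AllEqual`, not as `K = 1`.
merge : Labelling V K → Fin V → Fin V → Labelling V K
merge ℓ a b x with ℓ x Fin.≟ ℓ b
... | yes _ = ℓ a
... | no  _ = ℓ x

Merged : Labelling V K → (a b x y : Fin V) → Set
Merged ℓ a b x y = ℓ x ≡ ℓ y ⊎ (ℓ x ≡ ℓ a × ℓ y ≡ ℓ b) ⊎ (ℓ x ≡ ℓ b × ℓ y ≡ ℓ a)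

merge⇒Merged : (ℓ : Labelling V K) → ∀ a b {x y} → merge ℓ a b x ≡ merge ℓ a b y → Merged ℓ a b x y
merge⇒Merged ℓ a b {x} {y} eq with ℓ x Fin.≟ ℓ b | ℓ y Fin.≟ ℓ b
... | yes p | yes q = inj₁ (trans p (sym q))
... | yes p | no _  = inj₂ (inj₂ (p , sym eq))
... | no _  | yes q = inj₂ (inj₁ (eq , q))
... | no _  | no _  = inj₁ eq

⊑-merge : (ℓ : Labelling V K) → ∀ a b → ℓ ⊑ merge ℓ a b
⊑-merge ℓ a b {x} {y} eq with ℓ x Fin.≟ ℓ b | ℓ y Fin.≟ ℓ b
... | yes p | yes q = refl
... | yes p | no q  = ⊥-elim (q (trans (sym eq) p))
... | no p  | yes q = ⊥-elim (p (trans eq q))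
... | no _  | no _  = eq

merge-joins : (ℓ : Labelling V K) → ∀ a b → merge ℓ a b a ≡ merge ℓ a b b
merge-joins ℓ a b with ℓ a Fin.≟ ℓ b | ℓ b Fin.≟ ℓ b
... | _     | no q = ⊥-elim (q refl)
... | yes _ | yes _ = refl
... | no _  | yes _ = refl

-- With `⊑-merge` and `merge-joins` this is the universal property of `merge ℓ a b`: the finest
-- coarsening of `ℓ` that joins `a` and `b`. Monotonicity, symmetry and commutation of merges follow
-- from it without looking at labels.
merge-least : {ℓ : Labelling V K} {ℓ′ : Labelling V K′} → ∀ {a b} →
              ℓ ⊑ ℓ′ → ℓ′ a ≡ ℓ′ b → merge ℓ a b ⊑ ℓ′
merge-least {ℓ = ℓ} {a = a} {b} sub e eq with merge⇒Merged ℓ a b eq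
... | inj₁ p              = sub p
... | inj₂ (inj₁ (p , q)) = trans (sub p) (trans e (sym (sub q)))
... | inj₂ (inj₂ (p , q)) = trans (sub p) (trans (sym e) (sym (sub q)))

merge-mono : {ℓ : Labelling V K} {ℓ′ : Labelling V K′} → ∀ a b → ℓ ⊑ ℓ′ → merge ℓ a b ⊑ merge ℓ′ a b
merge-mono {ℓ = ℓ} {ℓ′} a b sub = merge-least (⊑-merge ℓ′ a b ∘ sub) (merge-joins ℓ′ a b)

merge-cong : {ℓ : Labelling V K} {ℓ′ : Labelling V K′} → ∀ a b → ℓ ≋ ℓ′ → merge ℓ a b ≋ merge ℓ′ a b
merge-cong a b (f , g) = merge-mono a b f , merge-mono a b g

merge-flip : (ℓ : Labelling V K) → ∀ a b → merge ℓ a b ≋ merge ℓ b a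
merge-flip ℓ a b = go a b , go b a
  where
  go : ∀ a b → merge ℓ a b ⊑ merge ℓ b a
  go a b = merge-least (⊑-merge ℓ b a) (sym (merge-joins ℓ b a))

merge-comm : (ℓ : Labelling V K) → ∀ a b c d →
             merge (merge ℓ a b) c d ≋ merge (merge ℓ c d) a b
merge-comm ℓ a b c d = go a b c d , go c d a b
  where
  go : ∀ a b c d → merge (merge ℓ a b) c d ⊑ merge (merge ℓ c d) a b
  go a b c d = merge-least (merge-mono a b (⊑-merge ℓ c d))
                           (⊑-merge (merge ℓ c d) a b (merge-joins ℓ c d))

merge-absorb : (ℓ : Labelling V K) → ∀ {a b} → ℓ a ≡ ℓ b → merge ℓ a b ≋ ℓ
merge-absorb ℓ {a} {b} e = merge-least {ℓ = ℓ} {ℓ} id e , ⊑-merge ℓ a b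

-- If joining `a` and `b` is what identifies `c` and `d`, then both pairs connect the same two
-- classes, possibly in opposite directions.
merge-parallel : (ℓ : Labelling V K) → ∀ a b c d → ℓ c ≢ ℓ d →
                 merge ℓ a b c ≡ merge ℓ a b d → merge ℓ c d a ≡ merge ℓ c d b
merge-parallel ℓ a b c d c≢d eq with merge⇒Merged ℓ a b eq
... | inj₁ p = ⊥-elim (c≢d p)
... | inj₂ (inj₁ (p , q)) = trans (⊑-merge ℓ c d (sym p)) (trans (merge-joins ℓ c d) (⊑-merge ℓ c d q))
... | inj₂ (inj₂ (p , q)) = trans (⊑-merge ℓ c d (sym q)) (trans (sym (merge-joins ℓ c d)) (⊑-merge ℓ c d p))

merge-parallel-≋ : (ℓ : Labelling V K) → ∀ a b c d → ℓ c ≢ ℓ d →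
                   merge ℓ a b c ≡ merge ℓ a b d → merge ℓ a b ≋ merge ℓ c d
merge-parallel-≋ ℓ a b c d c≢d eq =
  merge-least (⊑-merge ℓ c d) (merge-parallel ℓ a b c d c≢d eq) , merge-least (⊑-merge ℓ a b) eq

-- Spanning trees by deletion and contraction

AllEqual : Labelling V K → Set
AllEqual ℓ = ∀ x y → ℓ x ≡ ℓ y

allEqual? : (ℓ : Labelling V K) → Dec (AllEqual ℓ)
allEqual? ℓ = all? λ x → all? λ y → ℓ x Fin.≟ ℓ y

-- T E ℓ is the number of spanning trees of the multigraph obtained from E by
-- identifying the vertices with equal labels.
T : Graph V → Labelling V K → ℕ
T [] ℓ with allEqual? ℓ
... | yes _ = 1
... | no _  = 0
T ((a , b) ∷ E) ℓ with ℓ a Fin.≟ ℓ b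
... | yes _ = T E ℓ
... | no _  = T E ℓ ℕ.+ T E (merge ℓ a b)

T-connected : (ℓ : Labelling V K) → AllEqual ℓ → T [] ℓ ≡ 1
T-connected ℓ h with allEqual? ℓ
... | yes _ = refl
... | no n  = ⊥-elim (n h)

T-disconnected : (ℓ : Labelling V K) → ¬ AllEqual ℓ → T [] ℓ ≡ 0
T-disconnected ℓ h with allEqual? ℓ
... | yes y = ⊥-elim (h y)
... | no _  = refl

T-loop : ∀ (E : Graph V) (ℓ : Labelling V K) {a b} → ℓ a ≡ ℓ b → T ((a , b) ∷ E) ℓ ≡ T E ℓ
T-loop E ℓ {a} {b} e with ℓ a Fin.≟ ℓ b
... | yes _ = refl
... | no n  = ⊥-elim (n e)

T-link : ∀ (E : Graph V) (ℓ : Labelling V K) {a b} → ℓ a ≢ ℓ b →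
         T ((a , b) ∷ E) ℓ ≡ T E ℓ ℕ.+ T E (merge ℓ a b)
T-link E ℓ {a} {b} ne with ℓ a Fin.≟ ℓ b
... | yes e = ⊥-elim (ne e)
... | no _  = refl

T-cong : (E : Graph V) {ℓ : Labelling V K} {ℓ′ : Labelling V K′} → ℓ ≋ ℓ′ → T E ℓ ≡ T E ℓ′
T-cong [] {ℓ} {ℓ′} (f , g) with allEqual? ℓ
... | yes y = sym (T-connected ℓ′ λ a b → f (y a b))
... | no n  = sym (T-disconnected ℓ′ λ y → n λ a b → g (y a b))
T-cong ((a , b) ∷ E) {ℓ} {ℓ′} (f , g) with ℓ a Fin.≟ ℓ b
... | yes e = trans (T-cong E (f , g)) (sym (T-loop E ℓ′ (f e)))
... | no ne = trans (cong₂ ℕ._+_ (T-cong E (f , g)) (T-cong E (merge-cong a b (f , g))))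
                    (sym (T-link E ℓ′ (ne ∘ g)))

T-swap : ∀ e f (E : Graph V) (ℓ : Labelling V K) → T (e ∷ f ∷ E) ℓ ≡ T (f ∷ e ∷ E) ℓ
T-swap (a , b) (c , d) E ℓ = go (ℓ a Fin.≟ ℓ b) (ℓ c Fin.≟ ℓ d)
  where
  open ≡-Reasoning
  ab cd : Labelling _ _
  ab = merge ℓ a b
  cd = merge ℓ c d

  loopˡ : ∀ {a b c d} → ℓ a ≡ ℓ b → ℓ c ≢ ℓ d →
          T ((a , b) ∷ (c , d) ∷ E) ℓ ≡ T ((c , d) ∷ (a , b) ∷ E) ℓ
  loopˡ {a} {b} {c} {d} p q = begin
    T ((a , b) ∷ (c , d) ∷ E) ℓ                              ≡⟨ T-loop _ ℓ p ⟩
    T ((c , d) ∷ E) ℓ                                        ≡⟨ T-link E ℓ q ⟩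
    T E ℓ ℕ.+ T E (merge ℓ c d)
      ≡⟨ cong₂ ℕ._+_ (T-loop E ℓ p) (T-loop E (merge ℓ c d) (⊑-merge ℓ c d p)) ⟨
    T ((a , b) ∷ E) ℓ ℕ.+ T ((a , b) ∷ E) (merge ℓ c d)      ≡⟨ T-link _ ℓ q ⟨
    T ((c , d) ∷ (a , b) ∷ E) ℓ                              ∎

  go : Dec (ℓ a ≡ ℓ b) → Dec (ℓ c ≡ ℓ d) → T ((a , b) ∷ (c , d) ∷ E) ℓ ≡ T ((c , d) ∷ (a , b) ∷ E) ℓ
  go (yes p) (yes q) = trans (trans (T-loop _ ℓ p) (T-loop E ℓ q)) (sym (trans (T-loop _ ℓ q) (T-loop E ℓ p)))
  go (yes p) (no q) = loopˡ p q
  go (no p) (yes q) = sym (loopˡ q p)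
  go (no p) (no q) with ab c Fin.≟ ab d
  -- Contracting `a b` turns `c d` into a loop, so the two edges are parallel and either contraction
  -- gives the same partition.
  ... | yes par = begin
    T ((a , b) ∷ (c , d) ∷ E) ℓ               ≡⟨ T-link _ ℓ p ⟩
    T ((c , d) ∷ E) ℓ ℕ.+ T ((c , d) ∷ E) ab  ≡⟨ cong₂ ℕ._+_ (T-link E ℓ q) (T-loop E ab par) ⟩
    (T E ℓ ℕ.+ T E cd) ℕ.+ T E ab
      ≡⟨ cong₂ (λ s t → (T E ℓ ℕ.+ s) ℕ.+ t) (sym (T-cong E ab≋cd)) (T-cong E ab≋cd) ⟩
    (T E ℓ ℕ.+ T E ab) ℕ.+ T E cd
      ≡⟨ cong₂ ℕ._+_ (T-link E ℓ p) (T-loop E cd (merge-parallel ℓ a b c d q par)) ⟨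
    T ((a , b) ∷ E) ℓ ℕ.+ T ((a , b) ∷ E) cd  ≡⟨ T-link _ ℓ q ⟨
    T ((c , d) ∷ (a , b) ∷ E) ℓ               ∎
    where
    ab≋cd : ab ≋ cd
    ab≋cd = merge-parallel-≋ ℓ a b c d q par
  -- Each of the four subsets of the two edges gives one term; exchanging the edges only exchanges
  -- the two middle terms.
  ... | no npar = begin
    T ((a , b) ∷ (c , d) ∷ E) ℓ               ≡⟨ T-link _ ℓ p ⟩
    T ((c , d) ∷ E) ℓ ℕ.+ T ((c , d) ∷ E) ab  ≡⟨ cong₂ ℕ._+_ (T-link E ℓ q) (T-link E ab npar) ⟩
    (T E ℓ ℕ.+ T E cd) ℕ.+ (T E ab ℕ.+ T E (merge ab c d))
      ≡⟨ cong (λ s → (T E ℓ ℕ.+ T E cd) ℕ.+ (T E ab ℕ.+ s)) (T-cong E (merge-comm ℓ a b c d)) ⟩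
    (T E ℓ ℕ.+ T E cd) ℕ.+ (T E ab ℕ.+ T E (merge cd a b))
      ≡⟨ interchange (T E ℓ) (T E cd) (T E ab) _ ⟩
    (T E ℓ ℕ.+ T E ab) ℕ.+ (T E cd ℕ.+ T E (merge cd a b))
      ≡⟨ cong₂ ℕ._+_ (T-link E ℓ p) (T-link E cd (npar ∘ merge-parallel ℓ c d a b p)) ⟨
    T ((a , b) ∷ E) ℓ ℕ.+ T ((a , b) ∷ E) cd  ≡⟨ T-link _ ℓ q ⟨
    T ((c , d) ∷ (a , b) ∷ E) ℓ               ∎

T-∷-cong : ∀ e {E F : Graph V} (ℓ : Labelling V K) → (∀ (ℓ : Labelling V K) → T E ℓ ≡ T F ℓ) →
           T (e ∷ E) ℓ ≡ T (e ∷ F) ℓ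
T-∷-cong (a , b) ℓ h with ℓ a Fin.≟ ℓ b
... | yes _ = h ℓ
... | no _  = cong₂ ℕ._+_ (h ℓ) (h _)

T-↭ : {E F : Graph V} → E ↭ F → (ℓ : Labelling V K) → T E ℓ ≡ T F ℓ
T-↭ _↭_.refl ℓ = refl
T-↭ (prep e p) ℓ = T-∷-cong e ℓ (T-↭ p)
T-↭ {E = _ ∷ _ ∷ E} (swap e f p) ℓ =
  trans (T-swap e f E ℓ) (T-∷-cong f ℓ λ ℓ → T-∷-cong e ℓ (T-↭ p))
T-↭ (_↭_.trans p q) ℓ = trans (T-↭ p ℓ) (T-↭ q ℓ)

T-flip : ∀ (E : Graph V) a b (ℓ : Labelling V K) → T ((a , b) ∷ E) ℓ ≡ T ((b , a) ∷ E) ℓ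
T-flip E a b ℓ with ℓ a Fin.≟ ℓ b
... | yes e = sym (T-loop E ℓ (sym e))
... | no ne = trans (cong (T E ℓ ℕ.+_) (T-cong E (merge-flip ℓ a b))) (sym (T-link E ℓ (ne ∘ sym)))

-- Edge subsets: their components and their cycles

mergeAll : (E : Graph V) → Subset (length E) → Labelling V K → Labelling V K
mergeAll [] S ℓ = ℓ
mergeAll (e ∷ E) (outside ∷ S) ℓ = mergeAll E S ℓ
mergeAll ((a , b) ∷ E) (inside ∷ S) ℓ = mergeAll E S (merge ℓ a b)

-- Acyclicity in incremental form: in list order, each chosen edge joins two classes that the
-- earlier ones have left apart. This follows the recursion of `T`; the definition by closed walks
-- is matched to it separately.
Forest : (E : Graph V) → Subset (length E) → Labelling V K → Set
Forest [] S ℓ = ⊤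
Forest (e ∷ E) (outside ∷ S) ℓ = Forest E S ℓ
Forest ((a , b) ∷ E) (inside ∷ S) ℓ = ℓ a ≢ ℓ b × Forest E S (merge ℓ a b)

mergeAll-cong : (E : Graph V) (S : Subset (length E)) {ℓ : Labelling V K} {ℓ′ : Labelling V K′} →
                ℓ ≋ ℓ′ → mergeAll E S ℓ ≋ mergeAll E S ℓ′
mergeAll-cong [] S eq = eq
mergeAll-cong (e ∷ E) (outside ∷ S) eq = mergeAll-cong E S eq
mergeAll-cong ((a , b) ∷ E) (inside ∷ S) eq = mergeAll-cong E S (merge-cong a b eq)

Forest-cong : (E : Graph V) (S : Subset (length E)) {ℓ : Labelling V K} {ℓ′ : Labelling V K′} →
              ℓ ≋ ℓ′ → Forest E S ℓ → Forest E S ℓ′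
Forest-cong [] S eq _ = tt
Forest-cong (e ∷ E) (outside ∷ S) eq h = Forest-cong E S eq h
Forest-cong ((a , b) ∷ E) (inside ∷ S) eq (ne , h) = ne ∘ proj₂ eq , Forest-cong E S (merge-cong a b eq) h

⊑-mergeAll : (E : Graph V) (S : Subset (length E)) (ℓ : Labelling V K) → ℓ ⊑ mergeAll E S ℓ
⊑-mergeAll [] S ℓ eq = eq
⊑-mergeAll (e ∷ E) (outside ∷ S) ℓ eq = ⊑-mergeAll E S ℓ eq
⊑-mergeAll ((a , b) ∷ E) (inside ∷ S) ℓ eq = ⊑-mergeAll E S (merge ℓ a b) (⊑-merge ℓ a b eq)

mergeAll-joins : (E : Graph V) (S : Subset (length E)) (ℓ : Labelling V K) → ∀ {e} → e Sub.∈ S →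
                 mergeAll E S ℓ (proj₁ (lookup E e)) ≡ mergeAll E S ℓ (proj₂ (lookup E e))
mergeAll-joins ((a , b) ∷ E) (inside ∷ S) ℓ here = ⊑-mergeAll E S (merge ℓ a b) (merge-joins ℓ a b)
mergeAll-joins ((a , b) ∷ E) (inside ∷ S) ℓ (there h) = mergeAll-joins E S (merge ℓ a b) h
mergeAll-joins (e ∷ E) (outside ∷ S) ℓ (there h) = mergeAll-joins E S ℓ h

module _ {R : Fin V → Fin V → Set} (R-sym : ∀ {x y} → R x y → R y x)
         (R-trans : ∀ {x y z} → R x y → R y z → R x z) where

  -- The target is an arbitrary symmetric and transitive relation, not a labelling, because it is to
  -- be instantiated with being linked by a walk.
  mergeAll-least : (E : Graph V) (S : Subset (length E)) (ℓ : Labelling V K) →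
                   (∀ {x y} → ℓ x ≡ ℓ y → R x y) →
                   (∀ {e} → e Sub.∈ S → R (proj₁ (lookup E e)) (proj₂ (lookup E e))) →
                   ∀ {x y} → mergeAll E S ℓ x ≡ mergeAll E S ℓ y → R x y
  mergeAll-least [] S ℓ base edge = base
  mergeAll-least (e ∷ E) (outside ∷ S) ℓ base edge = mergeAll-least E S ℓ base (edge ∘ there)
  mergeAll-least ((a , b) ∷ E) (inside ∷ S) ℓ base edge =
    mergeAll-least E S (merge ℓ a b) base′ (edge ∘ there)
    where
    base′ : ∀ {x y} → merge ℓ a b x ≡ merge ℓ a b y → R x y
    base′ eq with merge⇒Merged ℓ a b eq
    ... | inj₁ p              = base p
    ... | inj₂ (inj₁ (p , q)) = R-trans (base p) (R-trans (edge here) (base (sym q)))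
    ... | inj₂ (inj₂ (p , q)) = R-trans (base p) (R-trans (R-sym (edge here)) (base (sym q)))

-- Adding the edge a b before or after the edges of S gives the same condition.
Forest-exchange⇒ : (E : Graph V) (S : Subset (length E)) (ℓ : Labelling V K) → ∀ {a b} →
                   ℓ a ≢ ℓ b → Forest E S (merge ℓ a b) →
                   mergeAll E S ℓ a ≢ mergeAll E S ℓ b × Forest E S ℓ
Forest-exchange⇒ [] S ℓ ne h = ne , tt
Forest-exchange⇒ (e ∷ E) (outside ∷ S) ℓ ne h = Forest-exchange⇒ E S ℓ ne h
Forest-exchange⇒ ((c , d) ∷ E) (inside ∷ S) ℓ {a} {b} ne (ne′ , h) =
  proj₁ ih , ne′ ∘ ⊑-merge ℓ a b , proj₂ ih
  where
  ih = Forest-exchange⇒ E S (merge ℓ c d) (ne′ ∘ merge-parallel ℓ c d a b ne)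
         (Forest-cong E S (merge-comm ℓ a b c d) h)

Forest-exchange⇐ : (E : Graph V) (S : Subset (length E)) (ℓ : Labelling V K) → ∀ {a b} →
                   mergeAll E S ℓ a ≢ mergeAll E S ℓ b → Forest E S ℓ →
                   ℓ a ≢ ℓ b × Forest E S (merge ℓ a b)
Forest-exchange⇐ [] S ℓ ne h = ne , tt
Forest-exchange⇐ (e ∷ E) (outside ∷ S) ℓ ne h = Forest-exchange⇐ E S ℓ ne h
Forest-exchange⇐ ((c , d) ∷ E) (inside ∷ S) ℓ {a} {b} ne (ne′ , h) =
  proj₁ ih ∘ ⊑-merge ℓ c d , proj₁ ih ∘ merge-parallel ℓ a b c d ne′ ,
  Forest-cong E S (merge-comm ℓ c d a b) (proj₂ ih)
  where
  ih = Forest-exchange⇐ E S (merge ℓ c d) ne h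

-- Walks

Linked : (E : Graph V) → Subset (length E) → Fin V → Fin V → Set
Linked E S u v = ∃ λ es → Walk E S u v es

Trail : (E : Graph V) → Subset (length E) → Fin V → Fin V → Set
Trail E S u v = ∃ λ es → Walk E S u v es × Unique es

Joins-sym : ∀ (e : Fin V × Fin V) {u v} → Joins e u v → Joins e v u
Joins-sym e (inj₁ p) = inj₂ p
Joins-sym e (inj₂ p) = inj₁ p

Joins-unique : ∀ (e : Fin V × Fin V) {u w x y} → Joins e u w → Joins e x y → u ≡ x ⊎ u ≡ y
Joins-unique _ (inj₁ (refl , refl)) (inj₁ (refl , refl)) = inj₁ refl
Joins-unique _ (inj₁ (refl , refl)) (inj₂ (refl , refl)) = inj₂ refl
Joins-unique _ (inj₂ (refl , refl)) (inj₁ (refl , refl)) = inj₂ refl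
Joins-unique _ (inj₂ (refl , refl)) (inj₂ (refl , refl)) = inj₁ refl

module _ {E : Graph V} {S : Subset (length E)} where

  Linked-step : ∀ {u v w} e → e Sub.∈ S → Joins (lookup E e) u w → Linked E S w v → Linked E S u v
  Linked-step e h j (es , p) = e ∷ es , step e h j p

  Linked-trans : ∀ {u v w} → Linked E S u v → Linked E S v w → Linked E S u w
  Linked-trans (_ , []) q = q
  Linked-trans (_ , step e h j p) q = Linked-step e h j (Linked-trans (_ , p) q)

  Linked-sym : ∀ {u v} → Linked E S u v → Linked E S v u
  Linked-sym (_ , []) = [] , []
  Linked-sym (_ , step e h j p) =
    Linked-trans (Linked-sym (_ , p)) (Linked-step e h (Joins-sym (lookup E e) j) ([] , []))

  -- Used when a walk is about to traverse `e` from `u` although `e` occurs again later. At that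
  -- occurrence `u` is one of the two ends of `e`, so the rest can be entered there, just before or
  -- just after `e`.
  trail-suffix : ∀ {e es u v w x} → Walk E S w v es → Unique es → e ∈ es →
                 Joins (lookup E e) u x → Trail E S u v
  trail-suffix p@(step e h j q) un@(_ ∷ un′) (here refl) j′ with Joins-unique (lookup E e) j′ j
  ... | inj₁ refl = _ , p , un
  ... | inj₂ refl = _ , q , un′
  trail-suffix (step _ h j q) (_ ∷ un) (there m) j′ = trail-suffix q un m j′

  -- `AcyclicOn` only speaks of closed walks without repeated edges, so a link has to be shortened
  -- to such a walk before an extra edge can close it to a cycle.
  walk⇒trail : ∀ {es u v} → Walk E S u v es → Trail E S u v
  walk⇒trail [] = [] , [] , []
  walk⇒trail (step e h j p) with walk⇒trail p
  ... | es , q , un with DecMembership._∈?_ Fin._≟_ e es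
  ...   | yes m = trail-suffix q un m j
  ...   | no m  = e ∷ es , step e h j q , All.tabulate (λ { m′ refl → m m′ }) ∷ un

mergeAll⇒Linked : (E : Graph V) (S : Subset (length E)) → ∀ {x y} →
                  mergeAll E S id x ≡ mergeAll E S id y → Linked E S x y
mergeAll⇒Linked E S = mergeAll-least {R = Linked E S} Linked-sym Linked-trans E S id
  (λ { refl → [] , [] }) (λ {e} h → e ∷ [] , step e h (inj₁ (refl , refl)) [])

Linked⇒mergeAll : (E : Graph V) (S : Subset (length E)) → ∀ {x y} →
                  Linked E S x y → mergeAll E S id x ≡ mergeAll E S id y
Linked⇒mergeAll E S (_ , []) = refl
Linked⇒mergeAll E S (_ , step e h (inj₁ (refl , refl)) p) =
  trans (mergeAll-joins E S id h) (Linked⇒mergeAll E S (_ , p))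
Linked⇒mergeAll E S (_ , step e h (inj₂ (refl , refl)) p) =
  trans (sym (mergeAll-joins E S id h)) (Linked⇒mergeAll E S (_ , p))

module _ {e₀ : Fin V × Fin V} {E : Graph V} {s : Bool} {S : Subset (length E)} where

  walk-raise : ∀ {u v es} → Walk E S u v es → Walk (e₀ ∷ E) (s ∷ S) u v (map suc es)
  walk-raise [] = []
  walk-raise (step e h j p) = step (suc e) (there h) j (walk-raise p)

  -- The condition is relative to membership in order to cover two situations: the head edge is
  -- outside the subset, or it has already been used by a walk that does not repeat edges.
  walk-lower : ∀ {u v es} → Walk (e₀ ∷ E) (s ∷ S) u v es → All (λ e → e Sub.∈ (s ∷ S) → zero ≢ e) es →
               ∃ λ es′ → es ≡ map suc es′ × Walk E S u v es′
  walk-lower [] _ = [] , refl , []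
  walk-lower (step zero h j p) (ne ∷ nes) = ⊥-elim (ne h refl)
  walk-lower (step (suc e) (there h) j p) (_ ∷ nes) with walk-lower p nes
  ... | es , refl , q = e ∷ es , refl , step e h j q

AcyclicOn-tail : ∀ {e₀} {E : Graph V} {s S} → AcyclicOn (e₀ ∷ E) (s ∷ S) → AcyclicOn E S
AcyclicOn-tail ac u es p un with es | ac u (map suc es) (walk-raise p) (Unique.map⁺ suc-injective un)
... | [] | _ = refl

zero∉map-suc : ∀ {n} (es : List (Fin n)) → All (Fin.zero ≢_) (map Fin.suc es)
zero∉map-suc [] = []
zero∉map-suc (e ∷ es) = (λ ()) ∷ zero∉map-suc es

AcyclicOn-head : ∀ {a b} {E : Graph V} {S} → AcyclicOn ((a , b) ∷ E) (inside ∷ S) → ¬ Linked E S a b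
AcyclicOn-head {b = b} ac (_ , p) with walk⇒trail p
... | es , q , un with ac b (zero ∷ map suc es) (step zero here (inj₂ (refl , refl)) (walk-raise q))
                        (zero∉map-suc es ∷ Unique.map⁺ suc-injective un)
...   | ()

-- The head edge is crossed at most once, so the trail either avoids it or consists of two pieces in
-- the remaining edges, in one of the two directions of crossing.
trail-split : ∀ {a b} {E : Graph V} {S u v es} → Walk ((a , b) ∷ E) (inside ∷ S) u v es → Unique es →
              (∃ λ es′ → es ≡ map suc es′ × Walk E S u v es′) ⊎
              (Linked E S u a × Linked E S b v) ⊎ (Linked E S u b × Linked E S a v)
trail-split [] _ = inj₁ ([] , refl , [])
trail-split (step zero h j p) (z∉ ∷ un) with walk-lower p (All.map (λ ne _ → ne) z∉) | j
... | es , _ , q | inj₁ (refl , refl) = inj₂ (inj₁ (([] , []) , es , q))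
... | es , _ , q | inj₂ (refl , refl) = inj₂ (inj₂ (([] , []) , es , q))
trail-split (step (suc e) (there h) j p) (_ ∷ un) with trail-split p un
... | inj₁ (es , refl , q)  = inj₁ (e ∷ es , refl , step e h j q)
... | inj₂ (inj₁ (q , q′)) = inj₂ (inj₁ (Linked-step e h j q , q′))
... | inj₂ (inj₂ (q , q′)) = inj₂ (inj₂ (Linked-step e h j q , q′))

lowered-trail-empty : ∀ {E : Graph V} {S u} {es : List (Fin (suc (length E)))} → AcyclicOn E S → Unique es →
                      (∃ λ es′ → es ≡ map suc es′ × Walk E S u u es′) → es ≡ []
lowered-trail-empty ac un (es , refl , p) = cong (map suc) (ac _ es p (Unique.map⁻ un))

AcyclicOn-inside : ∀ {a b} {E : Graph V} {S} → ¬ Linked E S a b → AcyclicOn E S →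
                   AcyclicOn ((a , b) ∷ E) (inside ∷ S)
AcyclicOn-inside nl ac u es p un with trail-split p un
... | inj₁ lowered          = lowered-trail-empty ac un lowered
... | inj₂ (inj₁ (q , q′)) = ⊥-elim (nl (Linked-sym (Linked-trans q′ q)))
... | inj₂ (inj₂ (q , q′)) = ⊥-elim (nl (Linked-trans q′ q))

AcyclicOn-outside : ∀ {e₀} {E : Graph V} {S} → AcyclicOn E S → AcyclicOn (e₀ ∷ E) (outside ∷ S)
AcyclicOn-outside ac u es p un =
  lowered-trail-empty ac un (walk-lower p (All.tabulate λ { _ () refl }))

-- The exchange moves the head edge behind all the others. There its condition says that its ends
-- are not linked by them, which is exactly what excludes a cycle through it.
Forest⇒Acyclic : (E : Graph V) (S : Subset (length E)) → Forest E S id → AcyclicOn E S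
Forest⇒Acyclic [] S h u [] _ _ = refl
Forest⇒Acyclic (e ∷ E) (outside ∷ S) h = AcyclicOn-outside (Forest⇒Acyclic E S h)
Forest⇒Acyclic ((a , b) ∷ E) (inside ∷ S) (ne , h) with Forest-exchange⇒ E S id ne h
... | ne′ , h′ = AcyclicOn-inside (ne′ ∘ Linked⇒mergeAll E S) (Forest⇒Acyclic E S h′)

Acyclic⇒Forest : (E : Graph V) (S : Subset (length E)) → AcyclicOn E S → Forest E S id
Acyclic⇒Forest [] S ac = tt
Acyclic⇒Forest (e ∷ E) (outside ∷ S) ac = Acyclic⇒Forest E S (AcyclicOn-tail ac)
Acyclic⇒Forest ((a , b) ∷ E) (inside ∷ S) ac =
  Forest-exchange⇐ E S id (AcyclicOn-head ac ∘ mergeAll⇒Linked E S) (Acyclic⇒Forest E S (AcyclicOn-tail ac))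

-- Counting

TreeOf : (E : Graph V) → Labelling V K → Subset (length E) → Set
TreeOf E ℓ S = AllEqual (mergeAll E S ℓ) × Forest E S ℓ

HasCount-cong : ∀ {k t} {P Q : Subset k → Set} → (∀ S → P S → Q S) → (∀ S → Q S → P S) →
                HasCount P t → HasCount Q t
HasCount-cong f g (L , un , len , sound , complete) =
  L , un , len , (λ S m → f S (sound S m)) , (λ S q → complete S (g S q))

HasCount-∷ : ∀ {k s t} {P : Subset (suc k) → Set} →
             HasCount (P ∘ (outside ∷_)) s → HasCount (P ∘ (inside ∷_)) t → HasCount P (s ℕ.+ t)
HasCount-∷ {P = P} (L , un , len , sound , complete) (L′ , un′ , len′ , sound′ , complete′) =
  map (outside ∷_) L ++ map (inside ∷_) L′ ,
  Unique.++⁺ (Unique.map⁺ ∷-injectiveʳ un) (Unique.map⁺ ∷-injectiveʳ un′) disjoint ,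
  trans (length-++ (map (outside ∷_) L))
        (cong₂ ℕ._+_ (trans (length-map _ L) len) (trans (length-map _ L′) len′)) ,
  sound″ , complete″
  where
  disjoint : ∀ {S} → ¬ (S ∈ map (outside ∷_) L × S ∈ map (inside ∷_) L′)
  disjoint (p , q) with ∈-map⁻ _ p | ∈-map⁻ _ q
  ... | _ , _ , refl | _ , _ , ()

  sound″ : ∀ S → S ∈ map (outside ∷_) L ++ map (inside ∷_) L′ → P S
  sound″ S m with ∈-++⁻ (map (outside ∷_) L) m
  ... | inj₁ p with ∈-map⁻ _ p
  ...   | S′ , p′ , refl = sound S′ p′
  sound″ S m | inj₂ p with ∈-map⁻ _ p
  ...   | S′ , p′ , refl = sound′ S′ p′

  complete″ : ∀ S → P S → S ∈ map (outside ∷_) L ++ map (inside ∷_) L′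
  complete″ (outside ∷ S) h = ∈-++⁺ˡ (∈-map⁺ _ (complete S h))
  complete″ (inside ∷ S) h = ∈-++⁺ʳ (map (outside ∷_) L) (∈-map⁺ _ (complete′ S h))

HasCount-none : ∀ {k} {P : Subset k → Set} → (∀ S → ¬ P S) → HasCount P 0
HasCount-none h = [] , [] , refl , (λ S ()) , (λ S p → ⊥-elim (h S p))

-- General in `ℓ`, since the subsets that contain the head edge are counted over the merged
-- labelling. A loop belongs to no tree, so that branch is then empty.
T-counts : (E : Graph V) (ℓ : Labelling V K) → HasCount (TreeOf E ℓ) (T E ℓ)
T-counts [] ℓ with allEqual? ℓ
... | yes h = [] ∷ [] , [] ∷ [] , refl , (λ { [] _ → h , tt }) , (λ { [] _ → here refl })
... | no h  = HasCount-none λ { [] (p , _) → h p }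
T-counts ((a , b) ∷ E) ℓ with ℓ a Fin.≟ ℓ b
... | yes e = subst (HasCount (TreeOf ((a , b) ∷ E) ℓ)) (ℕP.+-identityʳ (T E ℓ))
                (HasCount-∷ (T-counts E ℓ) (HasCount-none λ { S (_ , ne , _) → ne e }))
... | no ne = HasCount-∷ (T-counts E ℓ)
                (HasCount-cong (λ { S (p , q) → p , ne , q }) (λ { S (p , _ , q) → p , q }) (T-counts E (merge ℓ a b)))

T-spanningTrees : (E : Graph V) → NumSpanningTrees E (T E id)
T-spanningTrees E = HasCount-cong
  (λ { S (p , q) → (λ u v → mergeAll⇒Linked E S (p u v)) , Forest⇒Acyclic E S q })
  (λ { S (p , q) → (λ u v → Linked⇒mergeAll E S (p u v)) , Acyclic⇒Forest E S q })
  (T-counts E id)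

-- Always contracting, and skipping loops, ends in a single class; this one branch of the recursion
-- already contributes a tree.
T-positive : (E : Graph V) (ℓ : Labelling V K) → AllEqual (mergeAll E Sub.⊤ ℓ) → T E ℓ ≢ 0
T-positive [] ℓ h eq with trans (sym (T-connected ℓ h)) eq
... | ()
T-positive ((a , b) ∷ E) ℓ h with ℓ a Fin.≟ ℓ b
... | yes e = T-positive E ℓ λ x y → proj₁ (mergeAll-cong E Sub.⊤ (merge-absorb ℓ e)) (h x y)
... | no ne = T-positive E (merge ℓ a b) h ∘ ℕP.m+n≡0⇒n≡0 (T E ℓ)

connected⇒T-positive : (E : Graph V) → Connected E → T E id ≢ 0
connected⇒T-positive E c = T-positive E id λ x y → Linked⇒mergeAll E Sub.⊤ (c x y)

-- Contraction

merge-∘ : ∀ {M} (ℓ : Labelling V K) (c : Labelling M V) a b → merge ℓ (c a) (c b) ∘ c ≋ merge (ℓ ∘ c) a b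
merge-∘ ℓ c a b = (λ {x} {y} e → trans (sym (eq x)) (trans e (eq y))) ,
                  (λ {x} {y} e → trans (eq x) (trans e (sym (eq y))))
  where
  eq : ∀ x → merge ℓ (c a) (c b) (c x) ≡ merge (ℓ ∘ c) a b x
  eq x with ℓ (c x) Fin.≟ ℓ (c b)
  ... | yes _ = refl
  ... | no _  = refl

module _ (u v : Fin (suc V)) (u≢v : u ≢ v) where

  private
    c : Labelling (suc V) V
    c = contractVertex u v u≢v

  contractVertex-punchIn : ∀ y → c (punchIn v y) ≡ y
  contractVertex-punchIn y with punchIn v y Fin.≟ v
  ... | yes e = ⊥-elim (punchInᵢ≢i v y e)
  ... | no _  = punchOut-punchIn v

  contractVertex≋merge : c ≋ merge id u v
  contractVertex≋merge = (λ {x} {y} → to {x} {y}) , (λ {x} {y} → from {x} {y})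
    where
    to : c ⊑ merge id u v
    to {x} {y} eq with x Fin.≟ v | y Fin.≟ v
    ... | yes _ | yes _ = refl
    ... | yes _ | no _  = punchOut-injective {i = v} _ _ eq
    ... | no _  | yes _ = punchOut-injective {i = v} _ _ eq
    ... | no _  | no _  = punchOut-injective {i = v} _ _ eq
    from : merge id u v ⊑ c
    from {x} {y} eq with x Fin.≟ v | y Fin.≟ v
    ... | yes _ | yes _ = refl
    ... | yes _ | no _  = punchOut-cong v eq
    ... | no _  | yes _ = punchOut-cong v eq
    ... | no _  | no _  = punchOut-cong v eq

  -- The loops that `contract` deletes are the edges whose ends receive equal labels under `c`, and
  -- `T` skips those. Merges of `ℓ` occur in the induction, hence the general labelling.
  T-contract-∘ : (E : Graph (suc V)) (ℓ : Labelling V K) → T (contract E u v u≢v) ℓ ≡ T E (ℓ ∘ c)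
  T-contract-∘ [] ℓ with allEqual? ℓ
  ... | yes h = sym (T-connected (ℓ ∘ c) λ x y → h (c x) (c y))
  -- Equality on all values of `c` gives equality everywhere because `c` is surjective, with section
  -- `punchIn v`.
  ... | no h  = sym (T-disconnected (ℓ ∘ c) λ h′ → h λ x y →
                  subst₂ (λ x y → ℓ x ≡ ℓ y) (contractVertex-punchIn x) (contractVertex-punchIn y)
                         (h′ (punchIn v x) (punchIn v y)))
  T-contract-∘ ((a , b) ∷ E) ℓ with toℕ (c a) ℕ.≡ᵇ toℕ (c b) in loop?
  ... | true = trans (T-contract-∘ E ℓ) (sym (T-loop E (ℓ ∘ c) (cong ℓ (toℕ-injective
                 (ℕP.≡ᵇ⇒≡ _ _ (subst Bool.T (sym loop?) tt))))))
  ... | false with ℓ (c a) Fin.≟ ℓ (c b)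
  ...   | yes e = T-contract-∘ E ℓ
  ...   | no ne = cong₂ ℕ._+_ (T-contract-∘ E ℓ)
                    (trans (T-contract-∘ E (merge ℓ (c a) (c b))) (T-cong E (merge-∘ ℓ c a b)))

  T-contract : (E : Graph (suc V)) → T (contract E u v u≢v) id ≡ T E (merge id u v)
  T-contract E = trans (T-contract-∘ E id) (T-cong E contractVertex≋merge)

-- Embedding counts into the rationals

ℚ-ring : AlmostCommutativeRing 0ℓ 0ℓ
ℚ-ring = fromCommutativeRing ℚP.+-*-commutativeRing (λ x → dec⇒maybe (0ℚ ℚP.≟ x))

toℚᵘ-ℕ→ℚ : ∀ k → toℚᵘ (ℕ→ℚ k) ℚᵘ.≃ ℚᵘ.mkℚᵘ (ℤ.+ k) 0
toℚᵘ-ℕ→ℚ k = ℚP.toℚᵘ-fromℚᵘ (ℚᵘ.mkℚᵘ (ℤ.+ k) 0)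

ℕ→ℚ-+ : ∀ a b → ℕ→ℚ (a ℕ.+ b) ≡ ℕ→ℚ a + ℕ→ℚ b
ℕ→ℚ-+ a b = ℚP.toℚᵘ-injective (begin
  toℚᵘ (ℕ→ℚ (a ℕ.+ b))                ≈⟨ toℚᵘ-ℕ→ℚ (a ℕ.+ b) ⟩
  ℚᵘ.mkℚᵘ (ℤ.+ (a ℕ.+ b)) 0             ≈⟨ ℚᵘ.*≡* (cong (ℤ._* ℤ.+ 1) (cong₂ ℤ._+_ (ℤP.*-identityʳ (ℤ.+ a)) (ℤP.*-identityʳ (ℤ.+ b)))) ⟨
  ℚᵘ.mkℚᵘ (ℤ.+ a) 0 ℚᵘ.+ ℚᵘ.mkℚᵘ (ℤ.+ b) 0 ≈⟨ ℚᵘP.+-cong (toℚᵘ-ℕ→ℚ a) (toℚᵘ-ℕ→ℚ b) ⟨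
  toℚᵘ (ℕ→ℚ a) ℚᵘ.+ toℚᵘ (ℕ→ℚ b)      ≈⟨ ℚP.toℚᵘ-homo-+ (ℕ→ℚ a) (ℕ→ℚ b) ⟨
  toℚᵘ (ℕ→ℚ a + ℕ→ℚ b)                ∎)
  where open ℚᵘP.≃-Reasoning

ℕ→ℚ-* : ∀ a b → ℕ→ℚ (a ℕ.* b) ≡ ℕ→ℚ a * ℕ→ℚ b
ℕ→ℚ-* zero b = sym (ℚP.*-zeroˡ (ℕ→ℚ b))
ℕ→ℚ-* (suc a) b = begin
  ℕ→ℚ (b ℕ.+ a ℕ.* b)            ≡⟨ ℕ→ℚ-+ b (a ℕ.* b) ⟩
  ℕ→ℚ b + ℕ→ℚ (a ℕ.* b)          ≡⟨ cong (ℕ→ℚ b +_) (ℕ→ℚ-* a b) ⟩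
  ℕ→ℚ b + ℕ→ℚ a * ℕ→ℚ b          ≡⟨ distrib (ℕ→ℚ a) (ℕ→ℚ b) ⟩
  (1ℚ + ℕ→ℚ a) * ℕ→ℚ b           ≡⟨ cong (_* ℕ→ℚ b) (ℕ→ℚ-+ 1 a) ⟨
  ℕ→ℚ (suc a) * ℕ→ℚ b            ∎
  where
  open ≡-Reasoning
  distrib : ∀ x y → y + x * y ≡ (1ℚ + x) * y
  distrib = solve-∀ ℚ-ring

ℕ→ℚ-injective : ∀ {a b} → ℕ→ℚ a ≡ ℕ→ℚ b → a ≡ b
ℕ→ℚ-injective {a} {b} eq = ℤP.+-injective (trans (sym (ℤP.*-identityʳ (ℤ.+ a))) (trans h (ℤP.*-identityʳ (ℤ.+ b))))
  where
  h : ℤ.+ a ℤ.* ℤ.+ 1 ≡ ℤ.+ b ℤ.* ℤ.+ 1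
  h = ℚᵘP.drop-*≡* (ℚᵘP.≃-trans (ℚᵘP.≃-sym (toℚᵘ-ℕ→ℚ a))
        (ℚᵘP.≃-trans (ℚᵘP.≃-reflexive (cong toℚᵘ eq)) (toℚᵘ-ℕ→ℚ b)))

-- Sums over lists

lsum : {A : Set} → List A → (A → ℚ) → ℚ
lsum [] f = 0ℚ
lsum (x ∷ xs) f = f x + lsum xs f

module _ {A : Set} where

  lsum-cong : (xs : List A) {f g : A → ℚ} → (∀ x → f x ≡ g x) → lsum xs f ≡ lsum xs g
  lsum-cong [] h = refl
  lsum-cong (x ∷ xs) h = cong₂ _+_ (h x) (lsum-cong xs h)

  lsum-+ : (xs : List A) (f g : A → ℚ) → lsum xs (λ x → f x + g x) ≡ lsum xs f + lsum xs g
  lsum-+ [] f g = refl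
  lsum-+ (x ∷ xs) f g = trans (cong (f x + g x +_) (lsum-+ xs f g)) (rearrange (f x) (g x) _ _)
    where
    rearrange : ∀ a b c d → a + b + (c + d) ≡ a + c + (b + d)
    rearrange = solve-∀ ℚ-ring

  lsum-neg : (xs : List A) (f : A → ℚ) → lsum xs (λ x → - f x) ≡ - lsum xs f
  lsum-neg [] f = refl
  lsum-neg (x ∷ xs) f = trans (cong (- f x +_) (lsum-neg xs f)) (sym (ℚP.neg-distrib-+ (f x) _))

  lsum-zero : (xs : List A) {f : A → ℚ} → (∀ x → f x ≡ 0ℚ) → lsum xs f ≡ 0ℚ
  lsum-zero [] h = refl
  lsum-zero (x ∷ xs) h = cong₂ _+_ (h x) (lsum-zero xs h)

  lsum-++ : (xs ys : List A) (f : A → ℚ) → lsum (xs ++ ys) f ≡ lsum xs f + lsum ys f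
  lsum-++ [] ys f = sym (ℚP.+-identityˡ _)
  lsum-++ (x ∷ xs) ys f = trans (cong (f x +_) (lsum-++ xs ys f)) (sym (ℚP.+-assoc (f x) _ _))

  lsum-↭ : {xs ys : List A} (f : A → ℚ) → xs ↭ ys → lsum xs f ≡ lsum ys f
  lsum-↭ f _↭_.refl = refl
  lsum-↭ f (prep x p) = cong (f x +_) (lsum-↭ f p)
  lsum-↭ f (swap x y p) = trans (cong (λ s → f x + (f y + s)) (lsum-↭ f p)) (rearrange (f x) (f y) _)
    where
    rearrange : ∀ a b c → a + (b + c) ≡ b + (a + c)
    rearrange = solve-∀ ℚ-ring
  lsum-↭ f (_↭_.trans p q) = trans (lsum-↭ f p) (lsum-↭ f q)

-- The star identity

opaque
  t : Graph V → Labelling V K → ℚ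
  t E ℓ = ℕ→ℚ (T E ℓ)

  t≡T : (E : Graph V) (ℓ : Labelling V K) → t E ℓ ≡ ℕ→ℚ (T E ℓ)
  t≡T E ℓ = refl

  t-cong : {E F : Graph V} {ℓ : Labelling V K} {ℓ′ : Labelling V K′} → T E ℓ ≡ T F ℓ′ → t E ℓ ≡ t F ℓ′
  t-cong = cong ℕ→ℚ

  t-sum : {E F G : Graph V} {ℓ ℓ′ ℓ″ : Labelling V K} → T E ℓ ≡ T F ℓ′ ℕ.+ T G ℓ″ → t E ℓ ≡ t F ℓ′ + t G ℓ″
  t-sum {F = F} {G} {ℓ′ = ℓ′} {ℓ″} e = trans (cong ℕ→ℚ e) (ℕ→ℚ-+ (T F ℓ′) (T G ℓ″))

-- ρ E ℓ a b counts the spanning trees after identifying a and b (0 if they are already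
-- identified); the difference form makes every property a consequence of those of T.
ρ : Graph V → Labelling V K → Fin V → Fin V → ℚ
ρ E ℓ a b = t ((a , b) ∷ E) ℓ - t E ℓ

module _ (E : Graph V) (ℓ : Labelling V K) where

  t-loop : ∀ {a b} → ℓ a ≡ ℓ b → t ((a , b) ∷ E) ℓ ≡ t E ℓ
  t-loop e = t-cong (T-loop E ℓ e)

  t-link : ∀ {a b} → ℓ a ≢ ℓ b → t ((a , b) ∷ E) ℓ ≡ t E ℓ + t E (merge ℓ a b)
  t-link ne = t-sum (T-link E ℓ ne)

  ρ-loop : ∀ {a b} → ℓ a ≡ ℓ b → ρ E ℓ a b ≡ 0ℚ
  ρ-loop e = trans (cong (_- t E ℓ) (t-loop e)) (ℚP.+-inverseʳ (t E ℓ))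

  ρ-link : ∀ {a b} → ℓ a ≢ ℓ b → ρ E ℓ a b ≡ t E (merge ℓ a b)
  ρ-link ne = trans (cong (_- t E ℓ) (t-link ne)) (cancel (t E ℓ) _)
    where
    cancel : ∀ x y → x + y - x ≡ y
    cancel = solve-∀ ℚ-ring

  ρ-sym : ∀ a b → ρ E ℓ a b ≡ ρ E ℓ b a
  ρ-sym a b = cong (_- t E ℓ) (t-cong (T-flip E a b ℓ))

  ρ-congʳ : ∀ a {b b′} → ℓ b ≡ ℓ b′ → ρ E ℓ a b ≡ ρ E ℓ a b′
  ρ-congʳ a {b} {b′} e with ℓ a Fin.≟ ℓ b
  ... | yes p = trans (ρ-loop p) (sym (ρ-loop (trans p e)))
  ... | no p = begin
    ρ E ℓ a b            ≡⟨ ρ-link p ⟩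
    t E (merge ℓ a b)    ≡⟨ t-cong (T-cong E (sub e , sub (sym e))) ⟩
    t E (merge ℓ a b′)   ≡⟨ ρ-link (λ q → p (trans q (sym e))) ⟨
    ρ E ℓ a b′           ∎
    where
    open ≡-Reasoning
    sub : ∀ {b b′} → ℓ b ≡ ℓ b′ → merge ℓ a b ⊑ merge ℓ a b′
    sub {b} {b′} e = merge-least (⊑-merge ℓ a b′) (trans (merge-joins ℓ a b′) (⊑-merge ℓ a b′ (sym e)))

  ρ-∷-loop : ∀ {c d} → ℓ c ≡ ℓ d → ∀ a b → ρ ((c , d) ∷ E) ℓ a b ≡ ρ E ℓ a b
  ρ-∷-loop {c} {d} e a b = cong₂ _-_
    (t-cong (trans (T-swap (a , b) (c , d) E ℓ) (T-loop _ ℓ e))) (t-loop e)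

ρ-∷-link : ∀ (E : Graph V) (ℓ : Labelling V K) {c d} → ℓ c ≢ ℓ d → ∀ a b →
           ρ ((c , d) ∷ E) ℓ a b ≡ ρ E ℓ a b + ρ E (merge ℓ c d) a b
ρ-∷-link E ℓ {c} {d} ne a b = trans
  (cong₂ _-_ (trans (t-cong (T-swap (a , b) (c , d) E ℓ)) (t-link _ ℓ ne)) (t-link E ℓ ne))
  (rearrange (t ((a , b) ∷ E) ℓ) (t ((a , b) ∷ E) (merge ℓ c d)) (t E ℓ) (t E (merge ℓ c d)))
  where
  rearrange : ∀ x y z w → x + y - (z + w) ≡ x - z + (y - w)
  rearrange = solve-∀ ℚ-ring

ρ-↭ : {E F : Graph V} → E ↭ F → (ℓ : Labelling V K) → ∀ a b → ρ E ℓ a b ≡ ρ F ℓ a b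
ρ-↭ p ℓ a b = cong₂ _-_ (t-cong (T-↭ (prep (a , b) p) ℓ)) (t-cong (T-↭ p ℓ))

merge-apart : (ℓ : Labelling V K) → ∀ {a b z x} → ℓ z ≢ ℓ x → ℓ z ≢ ℓ a → ℓ z ≢ ℓ b →
              merge ℓ a b z ≢ merge ℓ a b x
merge-apart ℓ {a} {b} zx za zb eq with merge⇒Merged ℓ a b eq
... | inj₁ p             = zx p
... | inj₂ (inj₁ (p , _)) = za p
... | inj₂ (inj₂ (p , _)) = zb p

star : Fin V → List (Fin V) → Graph V
star w = map (w ,_)

module _ (w : Fin V) where

  -- T of a star is a product over the other classes of their number of edges to w, so
  -- this is d(v) Π + d(b) Π = (d(b) + d(v)) Π.
  star-three : ∀ zs (ℓ : Labelling V K) {b v} → ℓ w ≢ ℓ b → ℓ w ≢ ℓ v → ℓ b ≢ ℓ v →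
               T (star w zs) (merge ℓ w b) ℕ.+ T (star w zs) (merge ℓ w v) ≡ T (star w zs) (merge ℓ b v)
  star-three [] ℓ {b} {v} wb wv bv = trans
    (cong₂ ℕ._+_ (T-disconnected _ λ h → merge-apart ℓ (wv ∘ sym) (wv ∘ sym) (bv ∘ sym) (h v w))
                 (T-disconnected _ λ h → merge-apart ℓ (wb ∘ sym) (wb ∘ sym) bv (h b w)))
    (sym (T-disconnected _ λ h → merge-apart ℓ wb wb wv (h w b)))
  star-three (z ∷ zs) ℓ {b} {v} wb wv bv = go (ℓ w Fin.≟ ℓ z) (ℓ z Fin.≟ ℓ b) (ℓ z Fin.≟ ℓ v)
    where
    open ≡-Reasoning
    F : Graph V
    F = star w zs
    Goal : (b v : Fin V) → Set
    Goal b v = T ((w , z) ∷ F) (merge ℓ w b) ℕ.+ T ((w , z) ∷ F) (merge ℓ w v) ≡ T ((w , z) ∷ F) (merge ℓ b v)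

    -- The edge `w z` runs from `w` to the class of `b`. It is a loop once `w` and `b` are merged;
    -- in the other two counts its contraction brings `w`, `b` and `v` together, so the extra terms
    -- agree.
    parallel : ∀ {b v} → ℓ w ≢ ℓ b → ℓ w ≢ ℓ v → ℓ b ≢ ℓ v → ℓ z ≡ ℓ b →
               T F (merge ℓ w b) ℕ.+ T F (merge ℓ w v) ≡ T F (merge ℓ b v) → Goal b v
    parallel {b} {v} wb wv bv zb ih = begin
      T ((w , z) ∷ F) (merge ℓ w b) ℕ.+ T ((w , z) ∷ F) (merge ℓ w v)
        ≡⟨ cong₂ ℕ._+_ (T-loop F _ (trans (merge-joins ℓ w b) (⊑-merge ℓ w b (sym zb))))
                       (T-link F _ (λ e → merge-apart ℓ zw zw zv (sym e))) ⟩
      T F (merge ℓ w b) ℕ.+ (T F (merge ℓ w v) ℕ.+ T F (merge (merge ℓ w v) w z))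
        ≡⟨ ℕP.+-assoc (T F (merge ℓ w b)) _ _ ⟨
      T F (merge ℓ w b) ℕ.+ T F (merge ℓ w v) ℕ.+ T F (merge (merge ℓ w v) w z)
        ≡⟨ cong₂ ℕ._+_ ih (T-cong F (to , from)) ⟩
      T F (merge ℓ b v) ℕ.+ T F (merge (merge ℓ b v) w z)
        ≡⟨ T-link F _ (merge-apart ℓ wz wb wv) ⟨
      T ((w , z) ∷ F) (merge ℓ b v) ∎
      where
      wz : ℓ w ≢ ℓ z
      wz e = wb (trans e zb)
      zw : ℓ z ≢ ℓ w
      zw = wz ∘ sym
      zv : ℓ z ≢ ℓ v
      zv e = bv (trans (sym zb) e)
      X Y : Labelling V _
      X = merge (merge ℓ w v) w z
      Y = merge (merge ℓ b v) w z
      ℓ⊑X : ℓ ⊑ X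
      ℓ⊑X = ⊑-merge (merge ℓ w v) w z ∘ ⊑-merge ℓ w v
      ℓ⊑Y : ℓ ⊑ Y
      ℓ⊑Y = ⊑-merge (merge ℓ b v) w z ∘ ⊑-merge ℓ b v
      Xwz : X w ≡ X z
      Xwz = merge-joins (merge ℓ w v) w z
      Ywz : Y w ≡ Y z
      Ywz = merge-joins (merge ℓ b v) w z
      to : X ⊑ Y
      to = merge-least (merge-least {ℓ = ℓ} ℓ⊑Y
             (trans Ywz (trans (ℓ⊑Y zb) (⊑-merge (merge ℓ b v) w z (merge-joins ℓ b v))))) Ywz
      from : Y ⊑ X
      from = merge-least (merge-least {ℓ = ℓ} ℓ⊑X
             (trans (ℓ⊑X (sym zb)) (trans (sym Xwz) (⊑-merge (merge ℓ w v) w z (merge-joins ℓ w v))))) Xwz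

    go : Dec (ℓ w ≡ ℓ z) → Dec (ℓ z ≡ ℓ b) → Dec (ℓ z ≡ ℓ v) → Goal b v
    go (yes e) _ _ = begin
      T ((w , z) ∷ F) (merge ℓ w b) ℕ.+ T ((w , z) ∷ F) (merge ℓ w v)
        ≡⟨ cong₂ ℕ._+_ (T-loop F _ (⊑-merge ℓ w b e)) (T-loop F _ (⊑-merge ℓ w v e)) ⟩
      T F (merge ℓ w b) ℕ.+ T F (merge ℓ w v)    ≡⟨ star-three zs ℓ wb wv bv ⟩
      T F (merge ℓ b v)                          ≡⟨ T-loop F _ (⊑-merge ℓ b v e) ⟨
      T ((w , z) ∷ F) (merge ℓ b v)              ∎
    go (no wz) (yes zb) _ = parallel wb wv bv zb (star-three zs ℓ wb wv bv)
    go (no wz) (no zb) (yes zv) = begin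
      T ((w , z) ∷ F) (merge ℓ w b) ℕ.+ T ((w , z) ∷ F) (merge ℓ w v)
        ≡⟨ ℕP.+-comm (T ((w , z) ∷ F) (merge ℓ w b)) _ ⟩
      T ((w , z) ∷ F) (merge ℓ w v) ℕ.+ T ((w , z) ∷ F) (merge ℓ w b)
        ≡⟨ parallel wv wb (bv ∘ sym) zv (trans (ℕP.+-comm (T F (merge ℓ w v)) _)
             (trans (star-three zs ℓ wb wv bv) (T-cong F (merge-flip ℓ b v)))) ⟩
      T ((w , z) ∷ F) (merge ℓ v b)
        ≡⟨ T-cong ((w , z) ∷ F) (merge-flip ℓ v b) ⟩
      T ((w , z) ∷ F) (merge ℓ b v) ∎
    go (no wz) (no zb) (no zv) = begin
      T ((w , z) ∷ F) (merge ℓ w b) ℕ.+ T ((w , z) ∷ F) (merge ℓ w v)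
        ≡⟨ cong₂ ℕ._+_ (T-link F _ (λ e → merge-apart ℓ zw zw zb (sym e)))
                       (T-link F _ (λ e → merge-apart ℓ zw zw zv (sym e))) ⟩
      (T F (merge ℓ w b) ℕ.+ T F (merge (merge ℓ w b) w z)) ℕ.+ (T F (merge ℓ w v) ℕ.+ T F (merge (merge ℓ w v) w z))
        ≡⟨ interchange (T F (merge ℓ w b)) _ _ _ ⟩
      (T F (merge ℓ w b) ℕ.+ T F (merge ℓ w v)) ℕ.+ (T F (merge (merge ℓ w b) w z) ℕ.+ T F (merge (merge ℓ w v) w z))
        ≡⟨ cong₂ ℕ._+_ (star-three zs ℓ wb wv bv)
             (trans (cong₂ ℕ._+_ (T-cong F (merge-comm ℓ w b w z)) (T-cong F (merge-comm ℓ w v w z)))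
               (trans (star-three zs (merge ℓ w z)
                        (λ e → merge-apart ℓ bw bw bz (sym e))
                        (λ e → merge-apart ℓ vw vw vz (sym e))
                        (merge-apart ℓ bv bw bz))
                      (T-cong F (merge-comm ℓ w z b v)))) ⟩
      T F (merge ℓ b v) ℕ.+ T F (merge (merge ℓ b v) w z)
        ≡⟨ T-link F _ (merge-apart ℓ wz wb wv) ⟨
      T ((w , z) ∷ F) (merge ℓ b v) ∎
      where
      zw = wz ∘ sym
      bw = wb ∘ sym
      bz = zb ∘ sym
      vw = wv ∘ sym
      vz = zv ∘ sym

  -- Twice the number of spanning two-component forests separating w from z and v.
  Q : Graph V → Labelling V K → (v z : Fin V) → ℚ
  Q E ℓ v z = ρ E ℓ w z + ρ E ℓ w v - ρ E ℓ z v

  module _ (E : Graph V) (ℓ : Labelling V K) where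

    Q-≡v : ∀ {v} → ℓ w ≡ ℓ v → ∀ z → Q E ℓ v z ≡ 0ℚ
    Q-≡v {v} e z = trans
      (cong₂ (λ x y → x + y - ρ E ℓ z v) (trans (ρ-sym E ℓ w z) (ρ-congʳ E ℓ z e)) (ρ-loop E ℓ e))
      (cancel (ρ E ℓ z v))
      where
      cancel : ∀ x → x + 0ℚ - x ≡ 0ℚ
      cancel = solve-∀ ℚ-ring

    Q-≡z : ∀ {z} → ℓ w ≡ ℓ z → ∀ v → Q E ℓ v z ≡ 0ℚ
    Q-≡z {z} e v = trans
      (cong₂ (λ x y → x + y - ρ E ℓ z v) (ρ-loop E ℓ e)
        (trans (ρ-sym E ℓ w v) (trans (ρ-congʳ E ℓ v e) (ρ-sym E ℓ v z))))
      (cancel (ρ E ℓ z v))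
      where
      cancel : ∀ x → 0ℚ + x - x ≡ 0ℚ
      cancel = solve-∀ ℚ-ring

    Q-∷-loop : ∀ {c d} → ℓ c ≡ ℓ d → ∀ v z → Q ((c , d) ∷ E) ℓ v z ≡ Q E ℓ v z
    Q-∷-loop e v z = cong₂ _-_ (cong₂ _+_ (ρ-∷-loop E ℓ e w z) (ρ-∷-loop E ℓ e w v)) (ρ-∷-loop E ℓ e z v)

    Q-∷-link : ∀ {c d} → ℓ c ≢ ℓ d → ∀ v z → Q ((c , d) ∷ E) ℓ v z ≡ Q E ℓ v z + Q E (merge ℓ c d) v z
    Q-∷-link ne v z = trans
      (cong₂ _-_ (cong₂ _+_ (ρ-∷-link E ℓ ne w z) (ρ-∷-link E ℓ ne w v)) (ρ-∷-link E ℓ ne z v))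
      (rearrange (ρ E ℓ w z) _ (ρ E ℓ w v) _ (ρ E ℓ z v) _)
      where
      rearrange : ∀ a a′ b b′ c c′ → a + a′ + (b + b′) - (c + c′) ≡ a + b - c + (a′ + b′ - c′)
      rearrange = solve-∀ ℚ-ring

  Q-↭ : {E F : Graph V} → E ↭ F → (ℓ : Labelling V K) → ∀ v z → Q E ℓ v z ≡ Q F ℓ v z
  Q-↭ p ℓ v z = cong₂ _-_ (cong₂ _+_ (ρ-↭ p ℓ w z) (ρ-↭ p ℓ w v)) (ρ-↭ p ℓ z v)

  2t : Graph V → Labelling V K → ℚ
  2t E ℓ = t E ℓ + t E ℓ

  2t-link : ∀ (E : Graph V) (ℓ : Labelling V K) {a b} → ℓ a ≢ ℓ b →
            2t ((a , b) ∷ E) ℓ ≡ 2t E ℓ + 2t E (merge ℓ a b)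
  2t-link E ℓ {a} {b} ne = trans (cong₂ _+_ (t-link E ℓ ne) (t-link E ℓ ne)) (rearrange (t E ℓ) _)
    where
    rearrange : ∀ x y → x + y + (x + y) ≡ x + x + (y + y)
    rearrange = solve-∀ ℚ-ring

  lsum-Q-link : ∀ (E : Graph V) (ℓ : Labelling V K) {a b} → ℓ a ≢ ℓ b → ∀ v zs →
                lsum zs (Q ((a , b) ∷ E) ℓ v) ≡ lsum zs (Q E ℓ v) + lsum zs (Q E (merge ℓ a b) v)
  lsum-Q-link E ℓ ne v zs = trans (lsum-cong zs (Q-∷-link E ℓ ne v)) (lsum-+ zs _ _)

  star-identity : ∀ zs (ℓ : Labelling V K) {v} → ℓ w ≢ ℓ v →
                  lsum zs (Q (star w zs) ℓ v) ≡ 2t (star w zs) ℓ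
  star-identity [] ℓ {v} wv = sym (cong₂ _+_ z z)
    where
    z : t [] ℓ ≡ 0ℚ
    z = trans (t≡T [] ℓ) (cong ℕ→ℚ (T-disconnected ℓ λ h → wv (h w v)))
  star-identity (b ∷ zs) ℓ {v} wv with ℓ w Fin.≟ ℓ b | ℓ b Fin.≟ ℓ v
  ... | yes wb | _ = begin
    Q ((w , b) ∷ F) ℓ v b + lsum zs (Q ((w , b) ∷ F) ℓ v)
      ≡⟨ cong₂ _+_ (Q-≡z _ ℓ wb v) (lsum-cong zs (Q-∷-loop F ℓ wb v)) ⟩
    0ℚ + lsum zs (Q F ℓ v)  ≡⟨ ℚP.+-identityˡ _ ⟩
    lsum zs (Q F ℓ v)       ≡⟨ star-identity zs ℓ wv ⟩
    2t F ℓ                  ≡⟨ cong₂ _+_ (t-loop F ℓ wb) (t-loop F ℓ wb) ⟨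
    2t ((w , b) ∷ F) ℓ      ∎
    where
    open ≡-Reasoning
    F = star w zs
  -- Here `b` lies with `v`. Without the edge `w b`, the summand of `b` is `ρ + ρ - 0`, twice the
  -- number of trees through that edge; after contracting the edge, `w` lies with `v` and every
  -- summand vanishes.
  ... | no wb | yes bv = begin
    Q ((w , b) ∷ F) ℓ v b + lsum zs (Q ((w , b) ∷ F) ℓ v)
      ≡⟨ cong₂ _+_ (trans (Q-∷-link F ℓ wb v b) (cong₂ _+_ first second)) (lsum-Q-link F ℓ wb v zs) ⟩
    2t F ℓ/wb + 0ℚ + (lsum zs (Q F ℓ v) + lsum zs (Q F ℓ/wb v))
      ≡⟨ cong₂ (λ x y → 2t F ℓ/wb + 0ℚ + (x + y)) (star-identity zs ℓ wv)
           (lsum-zero zs (Q-≡v F ℓ/wb (trans (merge-joins ℓ w b) (⊑-merge ℓ w b bv)))) ⟩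
    2t F ℓ/wb + 0ℚ + (2t F ℓ + 0ℚ)  ≡⟨ rearrange (2t F ℓ/wb) (2t F ℓ) ⟩
    2t F ℓ + 2t F ℓ/wb              ≡⟨ 2t-link F ℓ wb ⟨
    2t ((w , b) ∷ F) ℓ              ∎
    where
    open ≡-Reasoning
    F = star w zs
    ℓ/wb = merge ℓ w b
    first : Q F ℓ v b ≡ 2t F ℓ/wb
    first = trans (cong₂ _-_ (cong₂ _+_ (ρ-link F ℓ wb) (trans (ρ-congʳ F ℓ w (sym bv)) (ρ-link F ℓ wb))) (ρ-loop F ℓ bv))
                  (ℚP.+-identityʳ _)
    second : Q F ℓ/wb v b ≡ 0ℚ
    second = Q-≡z F ℓ/wb (merge-joins ℓ w b) v
    rearrange : ∀ x y → x + 0ℚ + (y + 0ℚ) ≡ y + x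
    rearrange = solve-∀ ℚ-ring
  -- Here `w`, `b` and `v` lie in three classes. In a star two classes other than that of `w` meet
  -- only through `w`, so no forest keeps `b` and `v` together and apart from `w`; in tree counts
  -- this is `star-three`. The summand of `b` is therefore 0, and the deleted and contracted graphs
  -- are handled by induction.
  ... | no wb | no bv = begin
    Q ((w , b) ∷ F) ℓ v b + lsum zs (Q ((w , b) ∷ F) ℓ v)
      ≡⟨ cong₂ _+_ (trans (Q-∷-link F ℓ wb v b) (cong₂ _+_ first second)) (lsum-Q-link F ℓ wb v zs) ⟩
    0ℚ + 0ℚ + (lsum zs (Q F ℓ v) + lsum zs (Q F ℓ/wb v))
      ≡⟨ ℚP.+-identityˡ _ ⟩
    lsum zs (Q F ℓ v) + lsum zs (Q F ℓ/wb v)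
      ≡⟨ cong₂ _+_ (star-identity zs ℓ wv)
           (star-identity zs ℓ/wb (λ e → merge-apart ℓ (wv ∘ sym) (wv ∘ sym) (bv ∘ sym) (sym e))) ⟩
    2t F ℓ + 2t F ℓ/wb              ≡⟨ 2t-link F ℓ wb ⟨
    2t ((w , b) ∷ F) ℓ              ∎
    where
    open ≡-Reasoning
    F = star w zs
    ℓ/wb = merge ℓ w b
    first : Q F ℓ v b ≡ 0ℚ
    first = begin
      ρ F ℓ w b + ρ F ℓ w v - ρ F ℓ b v
        ≡⟨ cong₂ _-_ (cong₂ _+_ (ρ-link F ℓ wb) (ρ-link F ℓ wv)) (ρ-link F ℓ bv) ⟩
      t F (merge ℓ w b) + t F (merge ℓ w v) - t F (merge ℓ b v)
        ≡⟨ cong (_- t F (merge ℓ b v)) (sym (t-sum (sym (star-three zs ℓ wb wv bv)))) ⟩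
      t F (merge ℓ b v) - t F (merge ℓ b v)
        ≡⟨ ℚP.+-inverseʳ (t F (merge ℓ b v)) ⟩
      0ℚ ∎
    second : Q F ℓ/wb v b ≡ 0ℚ
    second = Q-≡z F ℓ/wb (merge-joins ℓ w b) v

  -- One entry per edge end at `w`, so parallel edges count with multiplicity; a loop at `w` gives
  -- none, as it carries no current.
  otherEnds : Fin V × Fin V → List (Fin V)
  otherEnds (a , b) with a Fin.≟ w | b Fin.≟ w
  ... | yes _ | yes _ = []
  ... | yes _ | no _  = b ∷ []
  ... | no _  | yes _ = a ∷ []
  ... | no _  | no _  = []

  neighbours : Graph V → List (Fin V)
  neighbours = concatMap otherEnds

  -- The edges at w are moved to the end of the list, so that they are processed last.
  neighbour-identity : ∀ (E : Graph V) zs (ℓ : Labelling V K) → (∀ {x} → ℓ w ≡ ℓ x → w ≡ x) → ∀ {v} → w ≢ v →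
                       lsum (neighbours E ++ zs) (Q (E ++ star w zs) ℓ v) ≡ 2t (E ++ star w zs) ℓ
  neighbour-identity [] zs ℓ single wv = star-identity zs ℓ (wv ∘ single)
  neighbour-identity ((a , b) ∷ E) zs ℓ single {v} wv with a Fin.≟ w | b Fin.≟ w
  ... | yes refl | yes refl = trans (lsum-cong (neighbours E ++ zs) (Q-∷-loop _ ℓ refl v))
          (trans (neighbour-identity E zs ℓ single wv) (sym (cong₂ _+_ (t-loop _ ℓ refl) (t-loop _ ℓ refl))))
  ... | yes refl | no _ = trans (lsum-cong (b ∷ neighbours E ++ zs) (Q-↭ move ℓ v))
          (trans (lsum-↭ _ (↭-sym (shift b (neighbours E) zs)))
            (trans (neighbour-identity E (b ∷ zs) ℓ single wv) (sym (cong₂ _+_ t-move t-move))))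
    where
    move : (w , b) ∷ E ++ star w zs ↭ E ++ star w (b ∷ zs)
    move = ↭-sym (shift (w , b) E (star w zs))
    t-move = t-cong (T-↭ move ℓ)
  ... | no _ | yes refl = trans (lsum-cong (a ∷ neighbours E ++ zs) Q-move)
          (trans (lsum-↭ _ (↭-sym (shift a (neighbours E) zs)))
            (trans (neighbour-identity E (a ∷ zs) ℓ single wv) (sym (cong₂ _+_ t-move t-move))))
    where
    move : (w , a) ∷ E ++ star w zs ↭ E ++ star w (a ∷ zs)
    move = ↭-sym (shift (w , a) E (star w zs))
    T-move : ∀ {K} (ℓ : Labelling V K) → T ((a , w) ∷ E ++ star w zs) ℓ ≡ T (E ++ star w (a ∷ zs)) ℓ
    T-move ℓ = trans (T-flip (E ++ star w zs) a w ℓ) (T-↭ move ℓ)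
    t-move = t-cong (T-move ℓ)
    ρ-move : ∀ x y → ρ ((a , w) ∷ E ++ star w zs) ℓ x y ≡ ρ (E ++ star w (a ∷ zs)) ℓ x y
    ρ-move x y = cong₂ _-_ (t-cong (T-∷-cong (x , y) ℓ T-move)) t-move
    Q-move : ∀ z → Q ((a , w) ∷ E ++ star w zs) ℓ v z ≡ Q (E ++ star w (a ∷ zs)) ℓ v z
    Q-move z = cong₂ _-_ (cong₂ _+_ (ρ-move w z) (ρ-move w v)) (ρ-move z v)
  ... | no a≢w | no b≢w with ℓ a Fin.≟ ℓ b
  ...   | yes e = trans (lsum-cong (neighbours E ++ zs) (Q-∷-loop _ ℓ e v))
          (trans (neighbour-identity E zs ℓ single wv) (sym (cong₂ _+_ (t-loop _ ℓ e) (t-loop _ ℓ e))))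
  ...   | no ne = trans (lsum-Q-link _ ℓ ne v (neighbours E ++ zs))
          (trans (cong₂ _+_ (neighbour-identity E zs ℓ single wv) (neighbour-identity E zs (merge ℓ a b) single′ wv))
                 (sym (2t-link _ ℓ ne)))
    where
    -- Only edges away from `w` are contracted at this stage, so `w` stays alone in its class and in
    -- particular apart from `v`.
    single′ : ∀ {x} → merge ℓ a b w ≡ merge ℓ a b x → w ≡ x
    single′ eq with merge⇒Merged ℓ a b eq
    ... | inj₁ p              = single p
    ... | inj₂ (inj₁ (p , _)) = ⊥-elim (a≢w (sym (single p)))
    ... | inj₂ (inj₂ (p , _)) = ⊥-elim (b≢w (sym (single p)))

-- Division

÷-inverse : ∀ x {y} → y ≢ 0ℚ → y * (x ÷ y) ≡ x
÷-inverse x {y} y≢0 with y ℚP.≟ 0ℚ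
... | yes e = ⊥-elim (y≢0 e)
... | no ne = trans (rearrange y x _) (trans (cong (x *_) (ℚP.*-inverseʳ y {{≢-nonZero ne}})) (ℚP.*-identityʳ x))
  where
  rearrange : ∀ y x z → y * (x * z) ≡ x * (y * z)
  rearrange = solve-∀ ℚ-ring

*-cancelˡ : ∀ {x y z} → x ≢ 0ℚ → x * y ≡ x * z → y ≡ z
*-cancelˡ {x} {y} {z} x≢0 eq = begin
  y                ≡⟨ ℚP.*-identityˡ y ⟨
  1ℚ * y           ≡⟨ cong (_* y) inverse ⟨
  1/x * x * y      ≡⟨ ℚP.*-assoc 1/x x y ⟩
  1/x * (x * y)    ≡⟨ cong (1/x *_) eq ⟩
  1/x * (x * z)    ≡⟨ ℚP.*-assoc 1/x x z ⟨
  1/x * x * z      ≡⟨ cong (_* z) inverse ⟩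
  1ℚ * z           ≡⟨ ℚP.*-identityˡ z ⟩
  z                ∎
  where
  open ≡-Reasoning
  1/x : ℚ
  1/x = (1/ x) {{≢-nonZero x≢0}}
  inverse : 1/x * x ≡ 1ℚ
  inverse = ℚP.*-inverseˡ x {{≢-nonZero x≢0}}

*-≢0 : ∀ {x y} → x ≢ 0ℚ → y ≢ 0ℚ → x * y ≢ 0ℚ
*-≢0 {x} x≢0 y≢0 eq = y≢0 (*-cancelˡ x≢0 (trans eq (sym (ℚP.*-zeroʳ x))))

÷-unique : ∀ {x y r} → y ≢ 0ℚ → x ≡ y * r → r ≡ x ÷ y
÷-unique {x} y≢0 eq = *-cancelˡ y≢0 (trans (sym eq) (sym (÷-inverse x y≢0)))

-- Resistances from potentials

ind : Bool → ℚ
ind true  = 1ℚ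
ind false = 0ℚ

δ : Fin V → Fin V → ℚ
δ x y = ind (does (x Fin.≟ y))

laplacian : Graph V → (Fin V → ℚ) → Fin V → ℚ
laplacian E g w = lsum (neighbours w E) (λ z → g w - g z)

laplacian-- : (E : Graph V) (g h : Fin V → ℚ) → ∀ w →
              laplacian E (λ z → g z - h z) w ≡ laplacian E g w - laplacian E h w
laplacian-- E g h w = begin
  lsum zs (λ z → g w - h w - (g z - h z))                     ≡⟨ lsum-cong zs (λ z → rearrange (g w) (h w) (g z) (h z)) ⟩
  lsum zs (λ z → g w - g z + - (h w - h z))                   ≡⟨ lsum-+ zs _ _ ⟩
  laplacian E g w + lsum zs (λ z → - (h w - h z))             ≡⟨ cong (laplacian E g w +_) (lsum-neg zs _) ⟩
  laplacian E g w - laplacian E h w                           ∎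
  where
  open ≡-Reasoning
  zs = neighbours w E
  rearrange : ∀ a b c d → a - b - (c - d) ≡ a - c + - (b - d)
  rearrange = solve-∀ ℚ-ring

module _ (E : Graph V) where

  private
    τ : ℚ
    τ = t E id

  -- The last sum is independent of `v`, so it cancels between two choices of `v`. The factor
  -- `1ℚ - δ w v` includes the vertex `w = v`, where each `Q` is 0.
  laplacian-ρ : ∀ v w → laplacian E (λ z → ρ E id z v) w ≡ (τ + τ) * (1ℚ - δ w v) - lsum (neighbours w E) (ρ E id w)
  laplacian-ρ v w = begin
    lsum zs (λ z → ρ E id w v - ρ E id z v)
      ≡⟨ lsum-cong zs (λ z → rearrange (ρ E id w z) (ρ E id w v) (ρ E id z v)) ⟩
    lsum zs (λ z → Q w E id v z + - ρ E id w z)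
      ≡⟨ lsum-+ zs _ _ ⟩
    lsum zs (Q w E id v) + lsum zs (λ z → - ρ E id w z)
      ≡⟨ cong₂ _+_ Q-sum (lsum-neg zs _) ⟩
    (τ + τ) * (1ℚ - δ w v) - lsum zs (ρ E id w) ∎
    where
    open ≡-Reasoning
    zs = neighbours w E
    rearrange : ∀ a b c → b - c ≡ a + b - c + - a
    rearrange = solve-∀ ℚ-ring
    Q-sum : lsum zs (Q w E id v) ≡ (τ + τ) * (1ℚ - δ w v)
    Q-sum with w Fin.≟ v
    ... | yes e = trans (lsum-zero zs (Q-≡v w E id e)) (sym (ℚP.*-zeroʳ (τ + τ)))
    ... | no ne = trans
      (subst₂ (λ zs F → lsum zs (Q w F id v) ≡ 2t w F id) (++-identityʳ zs) (++-identityʳ E)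
        (neighbour-identity w E [] id id ne))
      (sym (ℚP.*-identityʳ (τ + τ)))

  laplacian-ρ-difference : ∀ u v w →
    laplacian E (λ z → ρ E id z v - ρ E id z u) w ≡ (τ + τ) * (δ w u - δ w v)
  laplacian-ρ-difference u v w = begin
    laplacian E (λ z → ρ E id z v - ρ E id z u) w
      ≡⟨ laplacian-- E (λ z → ρ E id z v) (λ z → ρ E id z u) w ⟩
    laplacian E (λ z → ρ E id z v) w - laplacian E (λ z → ρ E id z u) w
      ≡⟨ cong₂ _-_ (laplacian-ρ v w) (laplacian-ρ u w) ⟩
    (τ + τ) * (1ℚ - δ w v) - κ - ((τ + τ) * (1ℚ - δ w u) - κ)
      ≡⟨ rearrange (τ + τ) (δ w v) (δ w u) κ ⟩
    (τ + τ) * (δ w u - δ w v) ∎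
    where
    open ≡-Reasoning
    κ = lsum (neighbours w E) (ρ E id w)
    rearrange : ∀ a x y k → a * (1ℚ - x) - k - (a * (1ℚ - y) - k) ≡ a * (y - x)
    rearrange = solve-∀ ℚ-ring

-- r is the potential drop from u to v per unit of current.
DropIs : Graph V → Fin V → Fin V → ℚ → Set
DropIs E u v r = ∀ g c → (∀ w → laplacian E g w ≡ c * (δ w u - δ w v)) → g u - g v ≡ c * r

-- The drop is evaluated at the potential built from `ρ`, with current `2 t`. Connectedness makes
-- the number of spanning trees nonzero, so that `÷` is a genuine division.
drop⇒resistance : (E : Graph V) → Connected E → ∀ {u v r} → u ≢ v → DropIs E u v r → ResistanceIs E u v r
drop⇒resistance {zero} E con {u = ()}
drop⇒resistance {suc V} E con {u} {v} {r} u≢v drop with u Fin.≟ v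
... | yes e = ⊥-elim (u≢v e)
... | no u≢v′ =
  T (contract E u v u≢v′) id , T E id , T-spanningTrees (contract E u v u≢v′) , T-spanningTrees E ,
  ÷-unique (connected⇒T-positive E con ∘ ℕ→ℚ-injective) (begin
    ℕ→ℚ (T (contract E u v u≢v′) id)   ≡⟨ cong ℕ→ℚ (T-contract u v u≢v′ E) ⟩
    ℕ→ℚ (T E (merge id u v))           ≡⟨ t≡T E (merge id u v) ⟨
    t E (merge id u v)                 ≡⟨ ρ-link E id u≢v ⟨
    ρ E id u v                         ≡⟨ half ⟩
    t E id * r                         ≡⟨ cong (_* r) (t≡T E id) ⟩
    ℕ→ℚ (T E id) * r                   ∎)
  where
  open ≡-Reasoning
  double : ∀ x → (1ℚ + 1ℚ) * x ≡ x - 0ℚ - (0ℚ - x)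
  double = solve-∀ ℚ-ring
  assoc : ∀ x r → (x + x) * r ≡ (1ℚ + 1ℚ) * (x * r)
  assoc = solve-∀ ℚ-ring
  half : ρ E id u v ≡ t E id * r
  half = *-cancelˡ {1ℚ + 1ℚ} (λ ()) (begin
    (1ℚ + 1ℚ) * ρ E id u v
      ≡⟨ double (ρ E id u v) ⟩
    ρ E id u v - 0ℚ - (0ℚ - ρ E id u v)
      ≡⟨ cong₂ _-_ (cong (λ x → ρ E id u v - x) (ρ-loop E id {u} refl)) (cong₂ _-_ (ρ-loop E id {v} refl) (ρ-sym E id v u)) ⟨
    ρ E id u v - ρ E id u u - (ρ E id v v - ρ E id v u)
      ≡⟨ drop (λ z → ρ E id z v - ρ E id z u) (t E id + t E id) (laplacian-ρ-difference E u v) ⟩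
    (t E id + t E id) * r
      ≡⟨ assoc (t E id) r ⟩
    (1ℚ + 1ℚ) * (t E id * r) ∎)

-- Sums over initial segments

-- Indexing by natural numbers lets `x_k` and `y_k` share the index `k` and lets sums over the first
-- `p` vertices be taken on either side.
sumTo : ℕ → (ℕ → ℚ) → ℚ
sumTo zero f = 0ℚ
sumTo (suc n) f = f 0 + sumTo n (f ∘ suc)

sumTo-cong : ∀ n {f g} → (∀ k → k < n → f k ≡ g k) → sumTo n f ≡ sumTo n g
sumTo-cong zero h = refl
sumTo-cong (suc n) h = cong₂ _+_ (h 0 (s≤s z≤n)) (sumTo-cong n λ k k<n → h (suc k) (s≤s k<n))

sumTo-sub : ∀ n f g → sumTo n (λ k → f k - g k) ≡ sumTo n f - sumTo n g
sumTo-sub zero f g = refl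
sumTo-sub (suc n) f g = trans (cong (f 0 - g 0 +_) (sumTo-sub n (f ∘ suc) (g ∘ suc))) (rearrange (f 0) (g 0) (sumTo n (f ∘ suc)) (sumTo n (g ∘ suc)))
  where
  rearrange : ∀ a b c d → a - b + (c - d) ≡ a + c - (b + d)
  rearrange = solve-∀ ℚ-ring

sumTo-* : ∀ n c f → sumTo n (λ k → c * f k) ≡ c * sumTo n f
sumTo-* zero c f = sym (ℚP.*-zeroʳ c)
sumTo-* (suc n) c f = trans (cong (c * f 0 +_) (sumTo-* n c (f ∘ suc))) (sym (ℚP.*-distribˡ-+ c (f 0) (sumTo n (f ∘ suc))))

sumTo-const : ∀ n c → sumTo n (λ _ → c) ≡ ℕ→ℚ n * c
sumTo-const zero c = sym (ℚP.*-zeroˡ c)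
sumTo-const (suc n) c = begin
  c + sumTo n (λ _ → c)        ≡⟨ cong (c +_) (sumTo-const n c) ⟩
  c + ℕ→ℚ n * c                ≡⟨ distrib (ℕ→ℚ n) c ⟩
  (1ℚ + ℕ→ℚ n) * c             ≡⟨ cong (_* c) (ℕ→ℚ-+ 1 n) ⟨
  ℕ→ℚ (suc n) * c              ∎
  where
  open ≡-Reasoning
  distrib : ∀ x y → y + x * y ≡ (1ℚ + x) * y
  distrib = solve-∀ ℚ-ring

sumTo-zero : ∀ n {f} → (∀ k → k < n → f k ≡ 0ℚ) → sumTo n f ≡ 0ℚ
sumTo-zero n h = trans (sumTo-cong n h) (trans (sumTo-const n 0ℚ) (ℚP.*-zeroʳ (ℕ→ℚ n)))

sumTo-δ : ∀ n (f : ℕ → ℚ) {k} → k < n → sumTo n (λ j → ind (j ≡ᵇ k) * f j) ≡ f k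
sumTo-δ (suc n) f {zero} _ = trans
  (cong₂ _+_ (ℚP.*-identityˡ (f 0)) (sumTo-zero n λ j _ → ℚP.*-zeroˡ (f (suc j)))) (ℚP.+-identityʳ (f 0))
sumTo-δ (suc n) f {suc k} (s≤s k<n) = trans
  (cong₂ _+_ (ℚP.*-zeroˡ (f 0)) (sumTo-δ n (f ∘ suc) k<n)) (ℚP.+-identityˡ (f (suc k)))

sumTo-truncate : ∀ {p n} → p ≤ n → ∀ f → sumTo n (λ k → ind (k <ᵇ p) * f k) ≡ sumTo p f
sumTo-truncate {n = n} z≤n f = sumTo-zero n λ k _ → ℚP.*-zeroˡ (f k)
sumTo-truncate {n = suc n} (s≤s p≤n) f = cong₂ _+_ (ℚP.*-identityˡ (f 0)) (sumTo-truncate p≤n (f ∘ suc))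

≡ᵇ-false : ∀ {j k} → j ≢ k → (j ≡ᵇ k) ≡ false
≡ᵇ-false {j} {k} ne = dec-false (j ℕP.≟ k) ne

≡ᵇ-true : ∀ {j k} → j ≡ k → (j ≡ᵇ k) ≡ true
≡ᵇ-true {j} {k} e = dec-true (j ℕP.≟ k) e

<ᵇ-false : ∀ {j k} → k ≤ j → (j <ᵇ k) ≡ false
<ᵇ-false {j} {k} le = dec-false (j ℕP.<? k) (ℕP.≤⇒≯ le)

<ᵇ-true : ∀ {j k} → j < k → (j <ᵇ k) ≡ true
<ᵇ-true {j} {k} lt = dec-true (j ℕP.<? k) lt

sumTo-ind-< : ∀ {n k} → k < n → sumTo n (λ j → ind (j ≡ᵇ k)) ≡ 1ℚ
sumTo-ind-< {n} {k} k<n = trans (sumTo-cong n λ j _ → sym (ℚP.*-identityʳ (ind (j ≡ᵇ k)))) (sumTo-δ n (λ _ → 1ℚ) k<n)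

sumTo-ind-≥ : ∀ {n k} → n ≤ k → sumTo n (λ j → ind (j ≡ᵇ k)) ≡ 0ℚ
sumTo-ind-≥ {n} {k} n≤k = sumTo-zero n λ j j<n → cong ind (≡ᵇ-false {j} {k} λ { refl → ℕP.<⇒≱ j<n n≤k })

-- The default 0 is harmless: a row equation can mention a partner out of range only with the factor
-- `ind (k <ᵇ p)`, which is 0 there since `p ≤ m` and `p ≤ n`.
extend : ∀ {n} → (Fin n → ℚ) → ℕ → ℚ
extend {zero} f k = 0ℚ
extend {suc n} f zero = f zero
extend {suc n} f (suc k) = extend (f ∘ suc) k

extend-toℕ : ∀ {n} (f : Fin n → ℚ) i → extend f (toℕ i) ≡ f i
extend-toℕ f zero = refl
extend-toℕ f (suc i) = extend-toℕ (f ∘ suc) i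

lsum-tabulate : ∀ {A : Set} n (h : Fin n → A) (f : A → ℚ) (F : ℕ → ℚ) → (∀ i → f (h i) ≡ F (toℕ i)) →
                lsum (tabulate h) f ≡ sumTo n F
lsum-tabulate zero h f F eq = refl
lsum-tabulate (suc n) h f F eq = cong₂ _+_ (eq zero) (lsum-tabulate n (h ∘ suc) f (F ∘ suc) (eq ∘ suc))

lsum-allFin : ∀ n {f : Fin n → ℚ} (F : ℕ → ℚ) → (∀ i → f i ≡ F (toℕ i)) → lsum (allFin n) f ≡ sumTo n F
lsum-allFin n F eq = lsum-tabulate n id _ F eq

module _ {A : Set} where

  lsum-concatMap : {B : Set} (h : A → List B) (xs : List A) (f : B → ℚ) →
                   lsum (concatMap h xs) f ≡ lsum xs (λ x → lsum (h x) f)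
  lsum-concatMap h [] f = refl
  lsum-concatMap h (x ∷ xs) f = trans (lsum-++ (h x) (concatMap h xs) f) (cong (lsum (h x) f +_) (lsum-concatMap h xs f))

  lsum-map : {B : Set} (h : A → B) (xs : List A) (f : B → ℚ) → lsum (map h xs) f ≡ lsum xs (f ∘ h)
  lsum-map h [] f = refl
  lsum-map h (x ∷ xs) f = cong (f (h x) +_) (lsum-map h xs f)

  lsum-filterᵇ : (q : A → Bool) (xs : List A) (f : A → ℚ) → lsum (filterᵇ q xs) f ≡ lsum xs (λ x → ind (q x) * f x)
  lsum-filterᵇ q [] f = refl
  lsum-filterᵇ q (x ∷ xs) f with q x
  ... | true  = cong₂ _+_ (sym (ℚP.*-identityˡ (f x))) (lsum-filterᵇ q xs f)
  ... | false = trans (lsum-filterᵇ q xs f) (trans (sym (ℚP.+-identityˡ _)) (cong (_+ _) (sym (ℚP.*-zeroˡ (f x)))))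

kept : ℕ → ℕ → ℕ → Bool
kept p i j = not ((i ≡ᵇ j) ∧ (i <ᵇ p))

ind-kept : ∀ p i j → ind (kept p i j) ≡ 1ℚ - ind (j ≡ᵇ i) * ind (i <ᵇ p)
ind-kept p i j with i ℕP.≟ j
... | yes refl rewrite ≡ᵇ-true (refl {x = i}) with i <ᵇ p
...   | true  = refl
...   | false = refl
ind-kept p i j | no ne rewrite ≡ᵇ-false ne | ≡ᵇ-false (ne ∘ sym) = sym (cong (λ x → 1ℚ - x) (ℚP.*-zeroˡ (ind (i <ᵇ p))))

kept-sym : ∀ p i j → kept p i j ≡ kept p j i
kept-sym p i j with i ℕP.≟ j
... | yes refl = refl
... | no ne rewrite ≡ᵇ-false ne | ≡ᵇ-false (ne ∘ sym) = refl

-- The full row of the complete bipartite graph minus the one removed edge; `p ≤ n` guarantees that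
-- this edge lies in the row whenever `i < p`.
sumTo-kept : ∀ {n p} → p ≤ n → ∀ i C Y →
             sumTo n (λ j → ind (kept p i j) * (C - Y j)) ≡ ℕ→ℚ n * C - sumTo n Y - ind (i <ᵇ p) * (C - Y i)
sumTo-kept {n} {p} p≤n i C Y = begin
  sumTo n (λ j → ind (kept p i j) * (C - Y j))
    ≡⟨ sumTo-cong n (λ j _ → trans (cong (_* (C - Y j)) (ind-kept p i j)) (rearrange (ind (j ≡ᵇ i)) (ind (i <ᵇ p)) (C - Y j))) ⟩
  sumTo n (λ j → (C - Y j) - ind (i <ᵇ p) * (ind (j ≡ᵇ i) * (C - Y j)))
    ≡⟨ sumTo-sub n _ _ ⟩
  sumTo n (λ j → C - Y j) - sumTo n (λ j → ind (i <ᵇ p) * (ind (j ≡ᵇ i) * (C - Y j)))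
    ≡⟨ cong₂ _-_ (trans (sumTo-sub n _ _) (cong (_- sumTo n Y) (sumTo-const n C))) diagonal ⟩
  ℕ→ℚ n * C - sumTo n Y - ind (i <ᵇ p) * (C - Y i) ∎
  where
  open ≡-Reasoning
  rearrange : ∀ a b x → (1ℚ - a * b) * x ≡ x - b * (a * x)
  rearrange = solve-∀ ℚ-ring
  diagonal : sumTo n (λ j → ind (i <ᵇ p) * (ind (j ≡ᵇ i) * (C - Y j))) ≡ ind (i <ᵇ p) * (C - Y i)
  diagonal with i ℕP.<? p
  ... | yes i<p = trans (sumTo-* n (ind (i <ᵇ p)) _) (cong (ind (i <ᵇ p) *_) (sumTo-δ n (λ j → C - Y j) (ℕP.<-≤-trans i<p p≤n)))
  ... | no i≮p rewrite <ᵇ-false (ℕP.≮⇒≥ i≮p) = trans (sumTo-zero n λ j _ → ℚP.*-zeroˡ (ind (j ≡ᵇ i) * (C - Y j))) (sym (ℚP.*-zeroˡ (C - Y i)))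

-- The graph G(m,n,p)

xv≢yv : ∀ {m n} (i : Fin m) (j : Fin n) → xv n i ≢ yv m j
xv≢yv {m} {n} i j eq with trans (sym (splitAt-↑ˡ m i n)) (trans (cong (Fin.splitAt m) eq) (splitAt-↑ʳ m n j))
... | ()

δ-xv : ∀ {m} n (i i′ : Fin m) → δ (xv n i) (xv n i′) ≡ ind (toℕ i ≡ᵇ toℕ i′)
δ-xv n i i′ = cong ind (does-⇔ (mk⇔ (cong toℕ ∘ ↑ˡ-injective n i i′) (cong (xv n) ∘ toℕ-injective))
                               (xv n i Fin.≟ xv n i′) (toℕ i ℕP.≟ toℕ i′))

δ-yv : ∀ m {n} (j j′ : Fin n) → δ (yv m j) (yv m j′) ≡ ind (toℕ j ≡ᵇ toℕ j′)
δ-yv m j j′ = cong ind (does-⇔ (mk⇔ (cong toℕ ∘ ↑ʳ-injective m j j′) (cong (yv m) ∘ toℕ-injective))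
                               (yv m j Fin.≟ yv m j′) (toℕ j ℕP.≟ toℕ j′))

δ-xy : ∀ {m n} (i : Fin m) (j : Fin n) → δ (xv n i) (yv m j) ≡ 0ℚ
δ-xy i j = cong ind (dec-false (xv _ i Fin.≟ yv _ j) (xv≢yv i j))

δ-yx : ∀ {m n} (i : Fin m) (j : Fin n) → δ (yv m j) (xv n i) ≡ 0ℚ
δ-yx i j = cong ind (dec-false (yv _ j Fin.≟ xv _ i) (xv≢yv i j ∘ sym))

lsum-otherEnds : ∀ (w a b : Fin V) (f : Fin V → ℚ) → a ≢ b →
                 lsum (otherEnds w (a , b)) f ≡ δ a w * f b + δ b w * f a
lsum-otherEnds w a b f a≢b with a Fin.≟ w | b Fin.≟ w
... | yes refl | yes refl = ⊥-elim (a≢b refl)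
... | yes _    | no _     = sym (trans (cong₂ _+_ (ℚP.*-identityˡ (f b)) (ℚP.*-zeroˡ (f a))) refl)
... | no _     | yes _    = trans (ℚP.+-comm (f a) 0ℚ) (sym (cong₂ _+_ (ℚP.*-zeroˡ (f b)) (ℚP.*-identityˡ (f a))))
... | no _     | no _     = sym (cong₂ _+_ (ℚP.*-zeroˡ (f b)) (ℚP.*-zeroˡ (f a)))

module _ (m n p : ℕ) (g : Fin (m ℕ.+ n) → ℚ) where

  gX gY : ℕ → ℚ
  gX = extend (g ∘ xv n)
  gY = extend (g ∘ yv m)

  gX-toℕ : ∀ i → gX (toℕ i) ≡ g (xv n i)
  gX-toℕ = extend-toℕ (g ∘ xv n)

  gY-toℕ : ∀ j → gY (toℕ j) ≡ g (yv m j)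
  gY-toℕ = extend-toℕ (g ∘ yv m)

  lsum-Gmnp : ∀ f (F : ℕ → ℕ → ℚ) → (∀ i j → f (xv n i , yv m j) ≡ F (toℕ i) (toℕ j)) →
              lsum (Gmnp m n p) f ≡ sumTo m (λ i → sumTo n (λ j → ind (kept p i j) * F i j))
  lsum-Gmnp f F eq = begin
    lsum (Gmnp m n p) f
      ≡⟨ lsum-concatMap _ (allFin m) f ⟩
    lsum (allFin m) (λ i → lsum (map (λ j → xv n i , yv m j) (filterᵇ (keepEdge p i) (allFin n))) f)
      ≡⟨ lsum-allFin m _ (λ i → trans (lsum-map _ (filterᵇ (keepEdge p i) (allFin n)) f)
           (trans (lsum-filterᵇ (keepEdge p i) (allFin n) _)
             (lsum-allFin n _ (λ j → cong (ind (keepEdge p i j) *_) (eq i j))))) ⟩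
    sumTo m (λ i → sumTo n (λ j → ind (kept p i j) * F i j)) ∎
    where open ≡-Reasoning

  laplacian-xv : p ≤ n → ∀ i → laplacian (Gmnp m n p) g (xv n i) ≡
    ℕ→ℚ n * gX (toℕ i) - sumTo n gY - ind (toℕ i <ᵇ p) * (gX (toℕ i) - gY (toℕ i))
  laplacian-xv p≤n i₀ = begin
    lsum (neighbours (xv n i₀) (Gmnp m n p)) f
      ≡⟨ lsum-concatMap (otherEnds (xv n i₀)) (Gmnp m n p) f ⟩
    lsum (Gmnp m n p) (λ e → lsum (otherEnds (xv n i₀) e) f)
      ≡⟨ lsum-Gmnp _ (λ i j → ind (i ≡ᵇ k) * (gX k - gY j)) edge ⟩
    sumTo m (λ i → sumTo n (λ j → ind (kept p i j) * (ind (i ≡ᵇ k) * (gX k - gY j))))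
      ≡⟨ sumTo-cong m (λ i _ → trans (sumTo-cong n λ j _ → rearrange (ind (kept p i j)) (ind (i ≡ᵇ k)) (gX k - gY j))
                                      (sumTo-* n (ind (i ≡ᵇ k)) _)) ⟩
    sumTo m (λ i → ind (i ≡ᵇ k) * sumTo n (λ j → ind (kept p i j) * (gX k - gY j)))
      ≡⟨ sumTo-δ m (λ i → sumTo n (λ j → ind (kept p i j) * (gX k - gY j))) (toℕ<n i₀) ⟩
    sumTo n (λ j → ind (kept p k j) * (gX k - gY j))
      ≡⟨ sumTo-kept p≤n k (gX k) gY ⟩
    ℕ→ℚ n * gX k - sumTo n gY - ind (k <ᵇ p) * (gX k - gY k) ∎
    where
    open ≡-Reasoning
    k = toℕ i₀
    f : Fin (m ℕ.+ n) → ℚ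
    f z = g (xv n i₀) - g z
    rearrange : ∀ a b x → a * (b * x) ≡ b * (a * x)
    rearrange = solve-∀ ℚ-ring
    edge : ∀ i j → lsum (otherEnds (xv n i₀) (xv n i , yv m j)) f ≡ ind (toℕ i ≡ᵇ k) * (gX k - gY (toℕ j))
    edge i j = begin
      lsum (otherEnds (xv n i₀) (xv n i , yv m j)) f
        ≡⟨ lsum-otherEnds (xv n i₀) (xv n i) (yv m j) f (xv≢yv i j) ⟩
      δ (xv n i) (xv n i₀) * f (yv m j) + δ (yv m j) (xv n i₀) * f (xv n i)
        ≡⟨ cong₂ _+_ (cong₂ _*_ (δ-xv n i i₀) (cong₂ _-_ (sym (gX-toℕ i₀)) (sym (gY-toℕ j))))
                     (trans (cong (_* f (xv n i)) (δ-yx i₀ j)) (ℚP.*-zeroˡ (f (xv n i)))) ⟩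
      ind (toℕ i ≡ᵇ k) * (gX k - gY (toℕ j)) + 0ℚ
        ≡⟨ ℚP.+-identityʳ _ ⟩
      ind (toℕ i ≡ᵇ k) * (gX k - gY (toℕ j)) ∎

  laplacian-yv : p ≤ m → ∀ j → laplacian (Gmnp m n p) g (yv m j) ≡
    ℕ→ℚ m * gY (toℕ j) - sumTo m gX - ind (toℕ j <ᵇ p) * (gY (toℕ j) - gX (toℕ j))
  laplacian-yv p≤m j₀ = begin
    lsum (neighbours (yv m j₀) (Gmnp m n p)) f
      ≡⟨ lsum-concatMap (otherEnds (yv m j₀)) (Gmnp m n p) f ⟩
    lsum (Gmnp m n p) (λ e → lsum (otherEnds (yv m j₀) e) f)
      ≡⟨ lsum-Gmnp _ (λ i j → ind (j ≡ᵇ k) * (gY k - gX i)) edge ⟩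
    sumTo m (λ i → sumTo n (λ j → ind (kept p i j) * (ind (j ≡ᵇ k) * (gY k - gX i))))
      ≡⟨ sumTo-cong m (λ i _ → trans (sumTo-cong n λ j _ → rearrange (ind (kept p i j)) (ind (j ≡ᵇ k)) (gY k - gX i))
                                      (sumTo-δ n (λ j → ind (kept p i j) * (gY k - gX i)) (toℕ<n j₀))) ⟩
    sumTo m (λ i → ind (kept p i k) * (gY k - gX i))
      ≡⟨ sumTo-cong m (λ i _ → cong (λ b → ind b * (gY k - gX i)) (kept-sym p i k)) ⟩
    sumTo m (λ i → ind (kept p k i) * (gY k - gX i))
      ≡⟨ sumTo-kept p≤m k (gY k) gX ⟩
    ℕ→ℚ m * gY k - sumTo m gX - ind (k <ᵇ p) * (gY k - gX k) ∎
    where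
    open ≡-Reasoning
    k = toℕ j₀
    f : Fin (m ℕ.+ n) → ℚ
    f z = g (yv m j₀) - g z
    rearrange : ∀ a b x → a * (b * x) ≡ b * (a * x)
    rearrange = solve-∀ ℚ-ring
    edge : ∀ i j → lsum (otherEnds (yv m j₀) (xv n i , yv m j)) f ≡ ind (toℕ j ≡ᵇ k) * (gY k - gX (toℕ i))
    edge i j = begin
      lsum (otherEnds (yv m j₀) (xv n i , yv m j)) f
        ≡⟨ lsum-otherEnds (yv m j₀) (xv n i) (yv m j) f (xv≢yv i j) ⟩
      δ (xv n i) (yv m j₀) * f (yv m j) + δ (yv m j) (yv m j₀) * f (xv n i)
        ≡⟨ cong₂ _+_ (trans (cong (_* f (yv m j)) (δ-xy i j₀)) (ℚP.*-zeroˡ (f (yv m j))))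
                     (cong₂ _*_ (δ-yv m j j₀) (cong₂ _-_ (sym (gY-toℕ j₀)) (sym (gX-toℕ i)))) ⟩
      0ℚ + ind (toℕ j ≡ᵇ k) * (gY k - gX (toℕ i))
        ≡⟨ ℚP.+-identityˡ _ ⟩
      ind (toℕ j ≡ᵇ k) * (gY k - gX (toℕ i)) ∎

-- Solving the Laplacian equations of G(m,n,p)

module Rows (m n p : ℕ) (p≤m : p ≤ m) (p≤n : p ≤ n) (gX gY Fx Fy : ℕ → ℚ) (c : ℚ)
  (rowX : ∀ k → k < m → ℕ→ℚ n * gX k - sumTo n gY - ind (k <ᵇ p) * (gX k - gY k) ≡ c * Fx k)
  (rowY : ∀ k → k < n → ℕ→ℚ m * gY k - sumTo m gX - ind (k <ᵇ p) * (gY k - gX k) ≡ c * Fy k) where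

  open ≡-Reasoning

  M N P D Dp GX GY W : ℚ
  M = ℕ→ℚ m
  N = ℕ→ℚ n
  P = ℕ→ℚ p
  D = M * N - M - N
  Dp = D + P
  GX = sumTo m gX
  GY = sumTo n gY
  W = N * GX - M * GY

  rowX< : ∀ {k} → k < p → N * gX k - GY - (gX k - gY k) ≡ c * Fx k
  rowX< {k} k<p = trans
    (sym (cong (λ s → N * gX k - GY - s) (trans (cong (λ b → ind b * (gX k - gY k)) (<ᵇ-true k<p)) (ℚP.*-identityˡ (gX k - gY k)))))
    (rowX k (ℕP.<-≤-trans k<p p≤m))

  rowY< : ∀ {k} → k < p → M * gY k - GX - (gY k - gX k) ≡ c * Fy k
  rowY< {k} k<p = trans
    (sym (cong (λ s → M * gY k - GX - s) (trans (cong (λ b → ind b * (gY k - gX k)) (<ᵇ-true k<p)) (ℚP.*-identityˡ (gY k - gX k)))))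
    (rowY k (ℕP.<-≤-trans k<p p≤n))

  rowX≥ : ∀ {k} → p ≤ k → k < m → N * gX k - GY ≡ c * Fx k
  rowX≥ {k} p≤k k<m = trans
    (sym (trans (cong (λ b → N * gX k - GY - ind b * (gX k - gY k)) (<ᵇ-false p≤k)) (vanish (N * gX k - GY) (gX k - gY k))))
    (rowX k k<m)
    where
    vanish : ∀ x y → x - 0ℚ * y ≡ x
    vanish = solve-∀ ℚ-ring

  rowY≥ : ∀ {k} → p ≤ k → k < n → M * gY k - GX ≡ c * Fy k
  rowY≥ {k} p≤k k<n = trans
    (sym (trans (cong (λ b → M * gY k - GX - ind b * (gY k - gX k)) (<ᵇ-false p≤k)) (vanish (M * gY k - GX) (gY k - gX k))))
    (rowY k k<n)
    where
    vanish : ∀ x y → x - 0ℚ * y ≡ x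
    vanish = solve-∀ ℚ-ring

  sumX : N * GX - M * GY - (sumTo p gX - sumTo p gY) ≡ c * sumTo m Fx
  sumX = begin
    N * GX - M * GY - (sumTo p gX - sumTo p gY)
      ≡⟨ cong₂ _-_ (cong₂ _-_ (sumTo-* m N gX) (sumTo-const m GY)) (trans (sumTo-truncate p≤m _) (sumTo-sub p gX gY)) ⟨
    sumTo m (λ k → N * gX k) - sumTo m (λ _ → GY) - sumTo m (λ k → ind (k <ᵇ p) * (gX k - gY k))
      ≡⟨ cong (_- sumTo m (λ k → ind (k <ᵇ p) * (gX k - gY k))) (sumTo-sub m (λ k → N * gX k) (λ _ → GY)) ⟨
    sumTo m (λ k → N * gX k - GY) - sumTo m (λ k → ind (k <ᵇ p) * (gX k - gY k))
      ≡⟨ sumTo-sub m (λ k → N * gX k - GY) (λ k → ind (k <ᵇ p) * (gX k - gY k)) ⟨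
    sumTo m (λ k → N * gX k - GY - ind (k <ᵇ p) * (gX k - gY k))
      ≡⟨ sumTo-cong m rowX ⟩
    sumTo m (λ k → c * Fx k)
      ≡⟨ sumTo-* m c Fx ⟩
    c * sumTo m Fx ∎

  -- Stated with both sides abstract because it is applied to the first `p` rows of the x's and,
  -- with the roles exchanged, of the y's.
  sum< : ∀ (a b F : ℕ → ℚ) A G → (∀ {k} → k < p → A * a k - G - (a k - b k) ≡ c * F k) →
         A * sumTo p a - P * G - (sumTo p a - sumTo p b) ≡ c * sumTo p F
  sum< a b F A G row = begin
    A * sumTo p a - P * G - (sumTo p a - sumTo p b)
      ≡⟨ cong₂ _-_ (cong₂ _-_ (sumTo-* p A a) (sumTo-const p G)) (sumTo-sub p a b) ⟨
    sumTo p (λ k → A * a k) - sumTo p (λ _ → G) - sumTo p (λ k → a k - b k)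
      ≡⟨ cong (_- sumTo p (λ k → a k - b k)) (sumTo-sub p (λ k → A * a k) (λ _ → G)) ⟨
    sumTo p (λ k → A * a k - G) - sumTo p (λ k → a k - b k)
      ≡⟨ sumTo-sub p (λ k → A * a k - G) (λ k → a k - b k) ⟨
    sumTo p (λ k → A * a k - G - (a k - b k))
      ≡⟨ sumTo-cong p (λ k k<p → row k<p) ⟩
    sumTo p (λ k → c * F k)
      ≡⟨ sumTo-* p c F ⟩
    c * sumTo p F ∎

  -- The weights `D`, `M` and `- N` on the three row sums are chosen to eliminate the partial sums
  -- over the first `p` vertices: their difference receives the coefficient `- D + M * N - M - N`,
  -- which is 0. The terms `P * GY` and `P * GX` combine to `P * W`.
  W-value : ∀ {F₀ F₁ F₂} → sumTo m Fx ≡ F₀ → sumTo p Fx ≡ F₁ → sumTo p Fy ≡ F₂ →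
            Dp * W ≡ c * (D * F₀ + M * F₁ - N * F₂)
  W-value refl refl refl = begin
    Dp * W
      ≡⟨ eliminate M N P (sumTo p gX) (sumTo p gY) GX GY ⟩
    D * (N * GX - M * GY - (sumTo p gX - sumTo p gY))
      + M * (N * sumTo p gX - P * GY - (sumTo p gX - sumTo p gY))
      - N * (M * sumTo p gY - P * GX - (sumTo p gY - sumTo p gX))
      ≡⟨ cong₂ _-_ (cong₂ _+_ (cong (D *_) sumX) (cong (M *_) (sum< gX gY Fx N GY rowX<))) (cong (N *_) (sum< gY gX Fy M GX rowY<)) ⟩
    D * (c * sumTo m Fx) + M * (c * sumTo p Fx) - N * (c * sumTo p Fy)
      ≡⟨ factor D M N c (sumTo m Fx) (sumTo p Fx) (sumTo p Fy) ⟩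
    c * (D * sumTo m Fx + M * sumTo p Fx - N * sumTo p Fy) ∎
    where
    eliminate : ∀ M N P a b GX GY → let D = M * N - M - N in
      (D + P) * (N * GX - M * GY) ≡
      D * (N * GX - M * GY - (a - b)) + M * (N * a - P * GY - (a - b)) - N * (M * b - P * GX - (b - a))
    eliminate = solve-∀ ℚ-ring
    factor : ∀ D M N c x y z → D * (c * x) + M * (c * y) - N * (c * z) ≡ c * (D * x + M * y - N * z)
    factor = solve-∀ ℚ-ring

  -- Cramer's rule for the rows of `x_k` and `y_k`, whose matrix has diagonal `N - 1`, `M - 1` and
  -- off-diagonal entries 1. The extra factor `N` allows `GX` to be traded for `W`, after which the
  -- coefficient of `GY` is the determinant itself.
  valueX< : ∀ {k fx fy} → k < p → Fx k ≡ fx → Fy k ≡ fy →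
            N * D * gX k ≡ N * (c * ((M - 1ℚ) * fx - fy)) + - 1ℚ * W + D * GY
  valueX< {k} k<p refl refl = begin
    N * D * gX k
      ≡⟨ eliminate M N (gX k) (gY k) GX GY ⟩
    N * ((M - 1ℚ) * (N * gX k - GY - (gX k - gY k)) - (M * gY k - GX - (gY k - gX k))) + - 1ℚ * W + D * GY
      ≡⟨ cong₂ (λ s t → N * ((M - 1ℚ) * s - t) + - 1ℚ * W + D * GY) (rowX< k<p) (rowY< k<p) ⟩
    N * ((M - 1ℚ) * (c * Fx k) - c * Fy k) + - 1ℚ * W + D * GY
      ≡⟨ cong (λ s → N * s + - 1ℚ * W + D * GY) (factor (M - 1ℚ) c (Fx k) (Fy k)) ⟩
    N * (c * ((M - 1ℚ) * Fx k - Fy k)) + - 1ℚ * W + D * GY ∎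
    where
    eliminate : ∀ M N x y GX GY → let D = M * N - M - N in
      N * D * x ≡ N * ((M - 1ℚ) * (N * x - GY - (x - y)) - (M * y - GX - (y - x))) + - 1ℚ * (N * GX - M * GY) + D * GY
    eliminate = solve-∀ ℚ-ring
    factor : ∀ a c x y → a * (c * x) - c * y ≡ c * (a * x - y)
    factor = solve-∀ ℚ-ring

  valueY< : ∀ {k fx fy} → k < p → Fx k ≡ fx → Fy k ≡ fy →
            N * D * gY k ≡ N * (c * ((N - 1ℚ) * fy - fx)) + (N - 1ℚ) * W + D * GY
  valueY< {k} k<p refl refl = begin
    N * D * gY k
      ≡⟨ eliminate M N (gX k) (gY k) GX GY ⟩
    N * ((N - 1ℚ) * (M * gY k - GX - (gY k - gX k)) - (N * gX k - GY - (gX k - gY k))) + (N - 1ℚ) * W + D * GY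
      ≡⟨ cong₂ (λ s t → N * ((N - 1ℚ) * s - t) + (N - 1ℚ) * W + D * GY) (rowY< k<p) (rowX< k<p) ⟩
    N * ((N - 1ℚ) * (c * Fy k) - c * Fx k) + (N - 1ℚ) * W + D * GY
      ≡⟨ cong (λ s → N * s + (N - 1ℚ) * W + D * GY) (factor (N - 1ℚ) c (Fy k) (Fx k)) ⟩
    N * (c * ((N - 1ℚ) * Fy k - Fx k)) + (N - 1ℚ) * W + D * GY ∎
    where
    eliminate : ∀ M N x y GX GY → let D = M * N - M - N in
      N * D * y ≡ N * ((N - 1ℚ) * (M * y - GX - (y - x)) - (N * x - GY - (x - y))) + (N - 1ℚ) * (N * GX - M * GY) + D * GY
    eliminate = solve-∀ ℚ-ring
    factor : ∀ a c x y → a * (c * x) - c * y ≡ c * (a * x - y)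
    factor = solve-∀ ℚ-ring

  -- No edge is missing at this vertex, so its row involves no partner. The term `0ℚ * W` brings the
  -- result to the same shape as in the other three cases.
  valueX≥ : ∀ {k fx} → p ≤ k → k < m → Fx k ≡ fx →
            N * N * gX k ≡ N * (c * fx) + 0ℚ * W + N * GY
  valueX≥ {k} p≤k k<m refl = begin
    N * N * gX k                                  ≡⟨ eliminate N (gX k) GY W ⟩
    N * (N * gX k - GY) + 0ℚ * W + N * GY         ≡⟨ cong (λ s → N * s + 0ℚ * W + N * GY) (rowX≥ p≤k k<m) ⟩
    N * (c * Fx k) + 0ℚ * W + N * GY              ∎
    where
    eliminate : ∀ N x GY W → N * N * x ≡ N * (N * x - GY) + 0ℚ * W + N * GY
    eliminate = solve-∀ ℚ-ring

  valueY≥ : ∀ {k fy} → p ≤ k → k < n → Fy k ≡ fy →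
            N * M * gY k ≡ N * (c * fy) + 1ℚ * W + M * GY
  valueY≥ {k} p≤k k<n refl = begin
    N * M * gY k                                  ≡⟨ eliminate M N (gY k) GX GY ⟩
    N * (M * gY k - GX) + 1ℚ * W + M * GY         ≡⟨ cong (λ s → N * s + 1ℚ * W + M * GY) (rowY≥ p≤k k<n) ⟩
    N * (c * Fy k) + 1ℚ * W + M * GY              ∎
    where
    eliminate : ∀ M N y GX GY → N * M * y ≡ N * (M * y - GX) + 1ℚ * (N * GX - M * GY) + M * GY
    eliminate = solve-∀ ℚ-ring

-- A potential x in terms of the still unknown sums: up to the common constant G / N it is
-- (c h + (ω / N) W) / d, where G = GY and W = N * GX - M * GY.
record Value (N W G c d h ω x : ℚ) : Set where
  constructor value
  field equation : N * d * x ≡ N * (c * h) + ω * W + d * G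

record Balance (Q W c σ : ℚ) : Set where
  constructor balance
  field equation : Q * W ≡ c * σ

-- The factor e clears the denominators of r that do not divide Q * N * d * d′.
drop-formula : ∀ {N Q W G c σ d d′ h h′ ω ω′ x x′} e r →
  Value N W G c d h ω x → Value N W G c d′ h′ ω′ x′ → Balance Q W c σ →
  e * (Q * N * d * d′) ≢ 0ℚ →
  e * (Q * N * d * d′) * r ≡ e * (Q * N * (h * d′ - h′ * d) + (ω * d′ - ω′ * d) * σ) →
  x - x′ ≡ c * r
drop-formula {N} {Q} {W} {G} {c} {σ} {d} {d′} {h} {h′} {ω} {ω′} {x} {x′} e r (value eq) (value eq′) (balance eqW) nz cert =
  *-cancelˡ nz (begin
    e * (Q * N * d * d′) * (x - x′)
      ≡⟨ expand e Q N d d′ x x′ ⟩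
    e * (Q * (d′ * (N * d * x) - d * (N * d′ * x′)))
      ≡⟨ cong₂ (λ s t → e * (Q * (d′ * s - d * t))) eq eq′ ⟩
    e * (Q * (d′ * (N * (c * h) + ω * W + d * G) - d * (N * (c * h′) + ω′ * W + d′ * G)))
      -- The terms with `G` are `d′ * (d * G)` and `d * (d′ * G)` and cancel: potentials are
      -- determined only up to a constant, and `G` carries that constant.
      ≡⟨ collect e Q N W G c d d′ h h′ ω ω′ ⟩
    e * (c * (Q * N * (h * d′ - h′ * d)) + (ω * d′ - ω′ * d) * (Q * W))
      ≡⟨ cong (λ s → e * (c * (Q * N * (h * d′ - h′ * d)) + (ω * d′ - ω′ * d) * s)) eqW ⟩
    e * (c * (Q * N * (h * d′ - h′ * d)) + (ω * d′ - ω′ * d) * (c * σ))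
      ≡⟨ factor e c (Q * N * (h * d′ - h′ * d)) (ω * d′ - ω′ * d) σ ⟩
    c * (e * (Q * N * (h * d′ - h′ * d) + (ω * d′ - ω′ * d) * σ))
      ≡⟨ cong (c *_) cert ⟨
    c * (e * (Q * N * d * d′) * r)
      ≡⟨ exchange c (e * (Q * N * d * d′)) r ⟩
    e * (Q * N * d * d′) * (c * r) ∎)
  where
  open ≡-Reasoning
  expand : ∀ e Q N d d′ x x′ → e * (Q * N * d * d′) * (x - x′) ≡ e * (Q * (d′ * (N * d * x) - d * (N * d′ * x′)))
  expand = solve-∀ ℚ-ring
  collect : ∀ e Q N W G c d d′ h h′ ω ω′ →
    e * (Q * (d′ * (N * (c * h) + ω * W + d * G) - d * (N * (c * h′) + ω′ * W + d′ * G))) ≡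
    e * (c * (Q * N * (h * d′ - h′ * d)) + (ω * d′ - ω′ * d) * (Q * W))
  collect = solve-∀ ℚ-ring
  factor : ∀ e c x y σ → e * (c * x + y * (c * σ)) ≡ c * (e * (x + y * σ))
  factor = solve-∀ ℚ-ring
  exchange : ∀ c k r → c * (k * r) ≡ k * (c * r)
  exchange = solve-∀ ℚ-ring

-- Consequences of connectedness for m and n

Gmnp-edge : ∀ m n p e → ∃₂ λ i j → lookup (Gmnp m n p) e ≡ (xv n i , yv m j) × Bool.T (keepEdge p i j)
Gmnp-edge m n p e with find (∈-concatMap⁻ _ {xs = allFin m} (∈-lookup {xs = Gmnp m n p} e))
... | i , _ , q with ∈-map⁻ _ q
...   | j , r , eq = i , j , eq , proj₂ (∈-filter⁻ (T? ∘ keepEdge p i) {xs = allFin n} r)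

-- The walk changes sides, so it is not empty, and its first edge is an edge at `y_j`.
yv-neighbour : ∀ {m n p S x y es} {i : Fin m} {j : Fin n} → Walk (Gmnp m n p) S x y es →
               x ≡ yv m j → y ≡ xv n i → ∃ λ i → Bool.T (keepEdge {m} p i j)
yv-neighbour {i = i} {j} Walk.[] eq eq′ = ⊥-elim (xv≢yv i j (trans (sym eq′) eq))
yv-neighbour {m} {n} {p} {j = j} (step e _ joins _) eq _ with Gmnp-edge m n p e | joins
... | i , _ , eq′ , _ | inj₁ (a , _) = ⊥-elim (xv≢yv i j (trans (sym (cong proj₁ eq′)) (trans a eq)))
... | i , j′ , eq′ , h | inj₂ (_ , b)
  rewrite ↑ʳ-injective m j′ j (trans (sym (cong proj₂ eq′)) (trans b eq)) = i , h

xv-neighbour : ∀ {m n p S x y es} {i : Fin m} {j : Fin n} → Walk (Gmnp m n p) S x y es →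
               x ≡ xv n i → y ≡ yv m j → ∃ λ j → Bool.T (keepEdge {n = n} p i j)
xv-neighbour {i = i} {j} Walk.[] eq eq′ = ⊥-elim (xv≢yv i j (trans (sym eq) eq′))
xv-neighbour {m} {n} {p} {i = i} (step e _ joins _) eq _ with Gmnp-edge m n p e | joins
... | _ , j , eq′ , _ | inj₂ (_ , b) = ⊥-elim (xv≢yv i j (trans (sym eq) (trans (sym b) (cong proj₂ eq′))))
... | i′ , j , eq′ , h | inj₁ (a , _)
  rewrite ↑ˡ-injective n i′ i (trans (sym (cong proj₁ eq′)) (trans a eq)) = j , h

-- If `m = 1`, then `x_1 y_1` is the only edge that could reach `y_1`, and it is removed because
-- `p > 0`.
connected⇒2≤m : ∀ {m n p} → 0 < p → p ≤ m → p ≤ n → Connected (Gmnp m n p) → 2 ≤ m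
connected⇒2≤m {suc zero} {suc n} {suc p} _ _ _ con
  with yv-neighbour {1} {suc n} {suc p} {i = zero} {zero} (proj₂ (con (yv 1 zero) (xv {1} (suc n) zero))) refl refl
... | zero , ()
connected⇒2≤m {suc (suc m)} _ _ _ _ = s≤s (s≤s z≤n)
connected⇒2≤m {zero} (s≤s _) () _ _
connected⇒2≤m {suc zero} {zero} (s≤s _) _ () _

connected⇒2≤n : ∀ {m n p} → 0 < p → p ≤ m → p ≤ n → Connected (Gmnp m n p) → 2 ≤ n
connected⇒2≤n {suc m} {suc zero} {suc p} _ _ _ con
  with xv-neighbour {suc m} {1} {suc p} {i = zero} {zero} (proj₂ (con (xv {suc m} 1 zero) (yv (suc m) zero))) refl refl
... | zero , ()
connected⇒2≤n {n = suc (suc n)} _ _ _ _ = s≤s (s≤s z≤n)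
connected⇒2≤n {n = zero} (s≤s _) _ () _
connected⇒2≤n {zero} {suc zero} (s≤s _) () _ _

m+n≤m*n : ∀ {m n} → 2 ≤ m → 2 ≤ n → m ℕ.+ n ≤ m ℕ.* n
m+n≤m*n {suc (suc a)} {suc (suc b)} _ _ =
  subst (2 ℕ.+ a ℕ.+ (2 ℕ.+ b) ≤_) (expand a b) (ℕP.m≤m+n (2 ℕ.+ a ℕ.+ (2 ℕ.+ b)) (a ℕ.+ b ℕ.+ a ℕ.* b))
  where
  expand : ∀ a b → 2 ℕ.+ a ℕ.+ (2 ℕ.+ b) ℕ.+ (a ℕ.+ b ℕ.+ a ℕ.* b) ≡ (2 ℕ.+ a) ℕ.* (2 ℕ.+ b)
  expand = ℕSolver.solve-∀
m+n≤m*n {suc zero} (s≤s ()) _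
m+n≤m*n {suc (suc _)} {suc zero} _ (s≤s ())

-- Potentials for a unit source and a unit sink

Vertex : ℕ → ℕ → Set
Vertex m n = Fin m ⊎ Fin n

vertex : ∀ {m n} → Vertex m n → Fin (m ℕ.+ n)
vertex {m} {n} (inj₁ i) = xv n i
vertex {m} {n} (inj₂ j) = yv m j

sourceX sourceY : ∀ {m n} → Vertex m n → ℕ → ℚ
sourceX (inj₁ i) k = ind (k ≡ᵇ toℕ i)
sourceX (inj₂ j) k = 0ℚ
sourceY (inj₁ i) k = 0ℚ
sourceY (inj₂ j) k = ind (k ≡ᵇ toℕ j)

δ-sourceX : ∀ {m n} (i : Fin m) (u : Vertex m n) → δ (xv n i) (vertex u) ≡ sourceX u (toℕ i)
δ-sourceX i (inj₁ i′) = δ-xv _ i i′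
δ-sourceX i (inj₂ j)  = δ-xy i j

δ-sourceY : ∀ {m n} (j : Fin n) (u : Vertex m n) → δ (yv m j) (vertex u) ≡ sourceY u (toℕ j)
δ-sourceY j (inj₁ i)  = δ-yx i j
δ-sourceY {m} j (inj₂ j′) = δ-yv m j j′

ind-same : ∀ {j k} → j ≡ k → ind (j ≡ᵇ k) ≡ 1ℚ
ind-same e = cong ind (≡ᵇ-true e)

ind-diff : ∀ {j k} → j ≢ k → ind (j ≡ᵇ k) ≡ 0ℚ
ind-diff ne = cong ind (≡ᵇ-false ne)

sumTo-0 : ∀ n → sumTo n (λ _ → 0ℚ) ≡ 0ℚ
sumTo-0 n = sumTo-zero n λ _ _ → refl

module Flow (m n p : ℕ) (p≤m : p ≤ m) (p≤n : p ≤ n) (u v : Vertex m n) (g : Fin (m ℕ.+ n) → ℚ) (c : ℚ)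
  (lap : ∀ w → laplacian (Gmnp m n p) g w ≡ c * (δ w (vertex u) - δ w (vertex v))) where

  X Y Fx Fy : ℕ → ℚ
  X = gX m n p g
  Y = gY m n p g
  Fx k = sourceX u k - sourceX v k
  Fy k = sourceY u k - sourceY v k

  rowX : ∀ k → k < m → ℕ→ℚ n * X k - sumTo n Y - ind (k <ᵇ p) * (X k - Y k) ≡ c * Fx k
  rowX k k<m = subst (λ k → ℕ→ℚ n * X k - sumTo n Y - ind (k <ᵇ p) * (X k - Y k) ≡ c * Fx k) (toℕ-fromℕ< k<m)
    (trans (sym (laplacian-xv m n p g p≤n i)) (trans (lap (xv n i)) (cong (c *_) (cong₂ _-_ (δ-sourceX i u) (δ-sourceX i v)))))
    where i = fromℕ< k<m

  rowY : ∀ k → k < n → ℕ→ℚ m * Y k - sumTo m X - ind (k <ᵇ p) * (Y k - X k) ≡ c * Fy k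
  rowY k k<n = subst (λ k → ℕ→ℚ m * Y k - sumTo m X - ind (k <ᵇ p) * (Y k - X k) ≡ c * Fy k) (toℕ-fromℕ< k<n)
    (trans (sym (laplacian-yv m n p g p≤m j)) (trans (lap (yv m j)) (cong (c *_) (cong₂ _-_ (δ-sourceY j u) (δ-sourceY j v)))))
    where j = fromℕ< k<n

  open Rows m n p p≤m p≤n X Y Fx Fy c rowX rowY public

  atX< : ∀ i {fx fy} → toℕ i < p → Fx (toℕ i) ≡ fx → Fy (toℕ i) ≡ fy →
         Value N W GY c D ((M - 1ℚ) * fx - fy) (- 1ℚ) (g (xv n i))
  atX< i {fx} {fy} i<p ex ey = subst (Value N W GY c D ((M - 1ℚ) * fx - fy) (- 1ℚ)) (gX-toℕ m n p g i) (value (valueX< i<p ex ey))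

  atY< : ∀ j {fx fy} → toℕ j < p → Fx (toℕ j) ≡ fx → Fy (toℕ j) ≡ fy →
         Value N W GY c D ((N - 1ℚ) * fy - fx) (N - 1ℚ) (g (yv m j))
  atY< j {fx} {fy} j<p ex ey = subst (Value N W GY c D ((N - 1ℚ) * fy - fx) (N - 1ℚ)) (gY-toℕ m n p g j) (value (valueY< j<p ex ey))

  atX≥ : ∀ i {fx} → p ≤ toℕ i → Fx (toℕ i) ≡ fx → Value N W GY c N fx 0ℚ (g (xv n i))
  atX≥ i {fx} p≤i ex = subst (Value N W GY c N fx 0ℚ) (gX-toℕ m n p g i) (value (valueX≥ p≤i (toℕ<n i) ex))

  atY≥ : ∀ j {fy} → p ≤ toℕ j → Fy (toℕ j) ≡ fy → Value N W GY c M fy 1ℚ (g (yv m j))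
  atY≥ j {fy} p≤j ey = subst (Value N W GY c M fy 1ℚ) (gY-toℕ m n p g j) (value (valueY≥ p≤j (toℕ<n j) ey))

  atW : ∀ {a a₁ a₂ b b₁ b₂} →
        sumTo m (sourceX u) ≡ a → sumTo p (sourceX u) ≡ a₁ → sumTo p (sourceY u) ≡ a₂ →
        sumTo m (sourceX v) ≡ b → sumTo p (sourceX v) ≡ b₁ → sumTo p (sourceY v) ≡ b₂ →
        Balance Dp W c (D * (a - b) + M * (a₁ - b₁) - N * (a₂ - b₂))
  atW refl refl refl refl refl refl = balance (W-value
    (sumTo-sub m (sourceX u) (sourceX v)) (sumTo-sub p (sourceX u) (sourceX v)) (sumTo-sub p (sourceY u) (sourceY v)))

-- Clearing denominators

record Cleared (K q s : ℚ) : Set where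
  constructor cleared
  field equation : K * q ≡ s

open Cleared using (equation)

-- `κ` is the cofactor of the denominator `b` in the common multiple `K`.
clear : ∀ {K b} κ a → b ≢ 0ℚ → K ≡ κ * b → Cleared K (a ÷ b) (κ * a)
clear {b = b} κ a b≢0 refl = cleared (trans (ℚP.*-assoc κ b (a ÷ b)) (cong (κ *_) (÷-inverse a b≢0)))

clear-+ : ∀ {K q₁ q₂ s₁ s₂} → Cleared K q₁ s₁ → Cleared K q₂ s₂ → Cleared K (q₁ + q₂) (s₁ + s₂)
clear-+ {K} {q₁} {q₂} (cleared refl) (cleared refl) = cleared (ℚP.*-distribˡ-+ K q₁ q₂)

clear-- : ∀ {K q₁ q₂ s₁ s₂} → Cleared K q₁ s₁ → Cleared K q₂ s₂ → Cleared K (q₁ - q₂) (s₁ - s₂)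
clear-- {K} {q₁} {q₂} (cleared refl) (cleared refl) = cleared (distrib K q₁ q₂)
  where
  distrib : ∀ K a b → K * (a - b) ≡ K * a - K * b
  distrib = solve-∀ ℚ-ring

module _ (M N P : ℚ) where

  private
    D Dp : ℚ
    D = M * N - M - N
    Dp = D + P

  -- This and the following identities are the certificates for `drop-formula`; their unsimplified
  -- shape is what that lemma produces once differences such as `1ℚ - 0ℚ` are evaluated. Here both
  -- ends have the same `d` and `ω`, so `W` drops out; `A` is `M - 1ℚ` for two x's and `N - 1ℚ` for
  -- two y's.
  clear-<< : ∀ A ω → D ≢ 0ℚ →
    1ℚ * (Dp * N * D * D) * (((1ℚ + 1ℚ) * A) ÷ D) ≡
    1ℚ * (Dp * N * ((A * 1ℚ - 0ℚ) * D - (A * - 1ℚ - 0ℚ) * D) + (ω * D - ω * D) * (D * 0ℚ + M * 0ℚ - N * 0ℚ))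
  clear-<< A ω D≢0 = trans (equation (clear (Dp * N * D) ((1ℚ + 1ℚ) * A) D≢0 (eq Dp N D))) (identity M Dp N D A ω)
    where
    eq : ∀ Dp N D → 1ℚ * (Dp * N * D * D) ≡ Dp * N * D * D
    eq = solve-∀ ℚ-ring
    identity : ∀ M Dp N D A ω → Dp * N * D * ((1ℚ + 1ℚ) * A) ≡
      1ℚ * (Dp * N * ((A * 1ℚ - 0ℚ) * D - (A * - 1ℚ - 0ℚ) * D) + (ω * D - ω * D) * (D * 0ℚ + M * 0ℚ - N * 0ℚ))
    identity = solve-∀ ℚ-ring

  -- The stated formula is written with `P` and `N - 1ℚ` in its denominators, while the drop itself
  -- only has `Dp`, `N` and `D`; this is the origin of the factor `P * (N - 1ℚ)`.
  clear-X<X≥ : N * (N - 1ℚ) ≢ 0ℚ → P * (N - 1ℚ) * D ≢ 0ℚ → P * N * (N - 1ℚ) * Dp ≢ 0ℚ →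
    P * (N - 1ℚ) * (Dp * N * D * N) *
      ((((1ℚ + 1ℚ) * N - 1ℚ) ÷ (N * (N - 1ℚ))) + ((P - 1ℚ) ÷ (P * (N - 1ℚ) * D)) + ((N - P) ÷ (P * N * (N - 1ℚ) * Dp))) ≡
    P * (N - 1ℚ) * (Dp * N * (((M - 1ℚ) * 1ℚ - 0ℚ) * N - (- 1ℚ) * D) + ((- 1ℚ) * N - 0ℚ * D) * (D * 0ℚ + M * 1ℚ - N * 0ℚ))
  clear-X<X≥ nz₁ nz₂ nz₃ = trans
    (equation (clear-+ (clear-+ (clear (P * N * D * Dp) ((1ℚ + 1ℚ) * N - 1ℚ) nz₁ (eq₁ P N D Dp))
                      (clear (N * N * Dp) (P - 1ℚ) nz₂ (eq₂ P N D Dp)))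
             (clear (N * D) (N - P) nz₃ (eq₃ P N D Dp))))
    (identity M N P)
    where
    eq₁ : ∀ P N D Dp → P * (N - 1ℚ) * (Dp * N * D * N) ≡ P * N * D * Dp * (N * (N - 1ℚ))
    eq₁ = solve-∀ ℚ-ring
    eq₂ : ∀ P N D Dp → P * (N - 1ℚ) * (Dp * N * D * N) ≡ N * N * Dp * (P * (N - 1ℚ) * D)
    eq₂ = solve-∀ ℚ-ring
    eq₃ : ∀ P N D Dp → P * (N - 1ℚ) * (Dp * N * D * N) ≡ N * D * (P * N * (N - 1ℚ) * Dp)
    eq₃ = solve-∀ ℚ-ring
    identity : ∀ M N P → let D = M * N - M - N; Dp = D + P in
      P * N * D * Dp * ((1ℚ + 1ℚ) * N - 1ℚ) + N * N * Dp * (P - 1ℚ) + N * D * (N - P) ≡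
      P * (N - 1ℚ) * (Dp * N * (((M - 1ℚ) * 1ℚ - 0ℚ) * N - (- 1ℚ) * D) + ((- 1ℚ) * N - 0ℚ * D) * (D * 0ℚ + M * 1ℚ - N * 0ℚ))
    identity = solve-∀ ℚ-ring

  clear-Y<Y≥ : M * (M - 1ℚ) ≢ 0ℚ → P * (M - 1ℚ) * D ≢ 0ℚ → P * M * (M - 1ℚ) * Dp ≢ 0ℚ →
    P * (M - 1ℚ) * (Dp * N * D * M) *
      ((((1ℚ + 1ℚ) * M - 1ℚ) ÷ (M * (M - 1ℚ))) + ((P - 1ℚ) ÷ (P * (M - 1ℚ) * D)) + ((M - P) ÷ (P * M * (M - 1ℚ) * Dp))) ≡
    P * (M - 1ℚ) * (Dp * N * (((N - 1ℚ) * 1ℚ - 0ℚ) * M - (- 1ℚ) * D) + ((N - 1ℚ) * M - 1ℚ * D) * (D * 0ℚ + M * 0ℚ - N * 1ℚ))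
  clear-Y<Y≥ nz₁ nz₂ nz₃ = trans
    (equation (clear-+ (clear-+ (clear (P * N * D * Dp) ((1ℚ + 1ℚ) * M - 1ℚ) nz₁ (eq₁ P M N D Dp))
                      (clear (N * M * Dp) (P - 1ℚ) nz₂ (eq₂ P M N D Dp)))
             (clear (N * D) (M - P) nz₃ (eq₃ P M N D Dp))))
    (identity M N P)
    where
    eq₁ : ∀ P M N D Dp → P * (M - 1ℚ) * (Dp * N * D * M) ≡ P * N * D * Dp * (M * (M - 1ℚ))
    eq₁ = solve-∀ ℚ-ring
    eq₂ : ∀ P M N D Dp → P * (M - 1ℚ) * (Dp * N * D * M) ≡ N * M * Dp * (P * (M - 1ℚ) * D)
    eq₂ = solve-∀ ℚ-ring
    eq₃ : ∀ P M N D Dp → P * (M - 1ℚ) * (Dp * N * D * M) ≡ N * D * (P * M * (M - 1ℚ) * Dp)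
    eq₃ = solve-∀ ℚ-ring
    identity : ∀ M N P → let D = M * N - M - N; Dp = D + P in
      P * N * D * Dp * ((1ℚ + 1ℚ) * M - 1ℚ) + N * M * Dp * (P - 1ℚ) + N * D * (M - P) ≡
      P * (M - 1ℚ) * (Dp * N * (((N - 1ℚ) * 1ℚ - 0ℚ) * M - (- 1ℚ) * D) + ((N - 1ℚ) * M - 1ℚ * D) * (D * 0ℚ + M * 0ℚ - N * 1ℚ))
    identity = solve-∀ ℚ-ring

  -- `f` is 1 if the two vertices are partners, `i = j`, and 0 otherwise. The two numerators `M + N`
  -- and `M + N - 2` are `M + N - 2 + 2 f`.
  clear-X<Y< : ∀ {S f} → D ≢ 0ℚ → D * Dp ≢ 0ℚ →
    (M - 1ℚ) * 1ℚ + (N - 1ℚ) + (1ℚ + 1ℚ) * f ≡ S →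
    1ℚ * (Dp * N * D * D) * ((S ÷ D) - ((M * N) ÷ (D * Dp))) ≡
    1ℚ * (Dp * N * (((M - 1ℚ) * 1ℚ - (- f)) * D - ((N - 1ℚ) * - 1ℚ - f) * D)
      + ((- 1ℚ) * D - (N - 1ℚ) * D) * (D * 1ℚ + M * 1ℚ - N * (- 1ℚ)))
  clear-X<Y< {f = f} nz₁ nz₂ refl = trans
    (equation (clear-- (clear (Dp * N * D) ((M - 1ℚ) * 1ℚ + (N - 1ℚ) + (1ℚ + 1ℚ) * f) nz₁ (eq₁ N D Dp))
             (clear (N * D) (M * N) nz₂ (eq₂ N D Dp))))
    (identity M N P f)
    where
    eq₁ : ∀ N D Dp → 1ℚ * (Dp * N * D * D) ≡ Dp * N * D * D
    eq₁ = solve-∀ ℚ-ring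
    eq₂ : ∀ N D Dp → 1ℚ * (Dp * N * D * D) ≡ N * D * (D * Dp)
    eq₂ = solve-∀ ℚ-ring
    identity : ∀ M N P f → let D = M * N - M - N; Dp = D + P in
      Dp * N * D * ((M - 1ℚ) * 1ℚ + (N - 1ℚ) + (1ℚ + 1ℚ) * f) - N * D * (M * N) ≡
      1ℚ * (Dp * N * (((M - 1ℚ) * 1ℚ - (- f)) * D - ((N - 1ℚ) * - 1ℚ - f) * D)
        + ((- 1ℚ) * D - (N - 1ℚ) * D) * (D * 1ℚ + M * 1ℚ - N * (- 1ℚ)))
    identity = solve-∀ ℚ-ring

  clear-X<Y≥ : M ≢ 0ℚ → P * D ≢ 0ℚ → P * M * Dp ≢ 0ℚ →
    P * (Dp * N * D * M) *
      ((1ℚ ÷ M) + (((P - 1ℚ) * (M - 1ℚ)) ÷ (P * D)) + (((M - P) * (M - 1ℚ)) ÷ (P * M * Dp))) ≡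
    P * (Dp * N * (((M - 1ℚ) * 1ℚ - 0ℚ) * M - (- 1ℚ) * D) + ((- 1ℚ) * M - 1ℚ * D) * (D * 1ℚ + M * 1ℚ - N * 0ℚ))
  clear-X<Y≥ nz₁ nz₂ nz₃ = trans
    (equation (clear-+ (clear-+ (clear (P * N * D * Dp) 1ℚ nz₁ (eq₁ P M N D Dp))
                      (clear (N * M * Dp) ((P - 1ℚ) * (M - 1ℚ)) nz₂ (eq₂ P M N D Dp)))
             (clear (N * D) ((M - P) * (M - 1ℚ)) nz₃ (eq₃ P M N D Dp))))
    (identity M N P)
    where
    eq₁ : ∀ P M N D Dp → P * (Dp * N * D * M) ≡ P * N * D * Dp * M
    eq₁ = solve-∀ ℚ-ring
    eq₂ : ∀ P M N D Dp → P * (Dp * N * D * M) ≡ N * M * Dp * (P * D)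
    eq₂ = solve-∀ ℚ-ring
    eq₃ : ∀ P M N D Dp → P * (Dp * N * D * M) ≡ N * D * (P * M * Dp)
    eq₃ = solve-∀ ℚ-ring
    identity : ∀ M N P → let D = M * N - M - N; Dp = D + P in
      P * N * D * Dp * 1ℚ + N * M * Dp * ((P - 1ℚ) * (M - 1ℚ)) + N * D * ((M - P) * (M - 1ℚ)) ≡
      P * (Dp * N * (((M - 1ℚ) * 1ℚ - 0ℚ) * M - (- 1ℚ) * D) + ((- 1ℚ) * M - 1ℚ * D) * (D * 1ℚ + M * 1ℚ - N * 0ℚ))
    identity = solve-∀ ℚ-ring

  clear-X≥Y< : N ≢ 0ℚ → P * D ≢ 0ℚ → P * N * Dp ≢ 0ℚ →
    P * (Dp * N * N * D) *
      ((1ℚ ÷ N) + (((P - 1ℚ) * (N - 1ℚ)) ÷ (P * D)) + (((N - P) * (N - 1ℚ)) ÷ (P * N * Dp))) ≡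
    P * (Dp * N * (1ℚ * D - ((N - 1ℚ) * - 1ℚ - 0ℚ) * N) + (0ℚ * D - (N - 1ℚ) * N) * (D * 1ℚ + M * 0ℚ - N * (- 1ℚ)))
  clear-X≥Y< nz₁ nz₂ nz₃ = trans
    (equation (clear-+ (clear-+ (clear (P * N * D * Dp) 1ℚ nz₁ (eq₁ P N D Dp))
                      (clear (N * N * Dp) ((P - 1ℚ) * (N - 1ℚ)) nz₂ (eq₂ P N D Dp)))
             (clear (N * D) ((N - P) * (N - 1ℚ)) nz₃ (eq₃ P N D Dp))))
    (identity M N P)
    where
    eq₁ : ∀ P N D Dp → P * (Dp * N * N * D) ≡ P * N * D * Dp * N
    eq₁ = solve-∀ ℚ-ring
    eq₂ : ∀ P N D Dp → P * (Dp * N * N * D) ≡ N * N * Dp * (P * D)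
    eq₂ = solve-∀ ℚ-ring
    eq₃ : ∀ P N D Dp → P * (Dp * N * N * D) ≡ N * D * (P * N * Dp)
    eq₃ = solve-∀ ℚ-ring
    identity : ∀ M N P → let D = M * N - M - N; Dp = D + P in
      P * N * D * Dp * 1ℚ + N * N * Dp * ((P - 1ℚ) * (N - 1ℚ)) + N * D * ((N - P) * (N - 1ℚ)) ≡
      P * (Dp * N * (1ℚ * D - ((N - 1ℚ) * - 1ℚ - 0ℚ) * N) + (0ℚ * D - (N - 1ℚ) * N) * (D * 1ℚ + M * 0ℚ - N * (- 1ℚ)))
    identity = solve-∀ ℚ-ring

  clear-X≥Y≥ : M ≢ 0ℚ → N ≢ 0ℚ → M * N * Dp ≢ 0ℚ →
    1ℚ * (Dp * N * N * M) * ((1ℚ ÷ M) + (1ℚ ÷ N) - (D ÷ (M * N * Dp))) ≡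
    1ℚ * (Dp * N * (1ℚ * M - (- 1ℚ) * N) + (0ℚ * M - 1ℚ * N) * (D * 1ℚ + M * 0ℚ - N * 0ℚ))
  clear-X≥Y≥ nz₁ nz₂ nz₃ = trans
    (equation (clear-- (clear-+ (clear (Dp * N * N) 1ℚ nz₁ (eq₁ M N Dp)) (clear (Dp * N * M) 1ℚ nz₂ (eq₂ M N Dp)))
             (clear N D nz₃ (eq₃ M N Dp))))
    (identity M N Dp D)
    where
    eq₁ : ∀ M N Dp → 1ℚ * (Dp * N * N * M) ≡ Dp * N * N * M
    eq₁ = solve-∀ ℚ-ring
    eq₂ : ∀ M N Dp → 1ℚ * (Dp * N * N * M) ≡ Dp * N * M * N
    eq₂ = solve-∀ ℚ-ring
    eq₃ : ∀ M N Dp → 1ℚ * (Dp * N * N * M) ≡ N * (M * N * Dp)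
    eq₃ = solve-∀ ℚ-ring
    identity : ∀ M N Dp D →
      Dp * N * N * 1ℚ + Dp * N * M * 1ℚ - N * D ≡
      1ℚ * (Dp * N * (1ℚ * M - (- 1ℚ) * N) + (0ℚ * M - 1ℚ * N) * (D * 1ℚ + M * 0ℚ - N * 0ℚ))
    identity = solve-∀ ℚ-ring

-- For two vertices of the same side with no missing edge: both are joined to the whole opposite
-- side, so subtracting their rows removes `G`, and the only division is by the degree `A`.
half-drop : ∀ {A x y G c} → A ≢ 0ℚ → A * x - G ≡ c * 1ℚ → A * y - G ≡ c * - 1ℚ → x - y ≡ c * ((1ℚ + 1ℚ) ÷ A)
half-drop {A} {x} {y} {G} {c} A≢0 ex ey = *-cancelˡ A≢0 (begin
  A * (x - y)                     ≡⟨ split A x y G ⟩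
  A * x - G - (A * y - G)         ≡⟨ cong₂ _-_ ex ey ⟩
  c * 1ℚ - c * - 1ℚ               ≡⟨ double c ⟩
  c * (1ℚ + 1ℚ)                   ≡⟨ cong (c *_) (÷-inverse (1ℚ + 1ℚ) A≢0) ⟨
  c * (A * ((1ℚ + 1ℚ) ÷ A))       ≡⟨ exchange c A ((1ℚ + 1ℚ) ÷ A) ⟩
  A * (c * ((1ℚ + 1ℚ) ÷ A))       ∎)
  where
  open ≡-Reasoning
  split : ∀ A x y G → A * (x - y) ≡ A * x - G - (A * y - G)
  split = solve-∀ ℚ-ring
  double : ∀ c → c * 1ℚ - c * - 1ℚ ≡ c * (1ℚ + 1ℚ)
  double = solve-∀ ℚ-ring
  exchange : ∀ c k r → c * (k * r) ≡ k * (c * r)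
  exchange = solve-∀ ℚ-ring

ℕ→ℚ-≢0 : ∀ {k} → 1 ≤ k → ℕ→ℚ k ≢ 0ℚ
ℕ→ℚ-≢0 {k} 1≤k eq = ℕP.<⇒≢ 1≤k (sym (ℕ→ℚ-injective {k} {0} eq))

ℕ→ℚ-1≢0 : ∀ {k} → 2 ≤ k → ℕ→ℚ k - 1ℚ ≢ 0ℚ
ℕ→ℚ-1≢0 {k} 2≤k eq = ℕP.<⇒≢ 2≤k (sym (ℕ→ℚ-injective {k} {1} (x∙y⁻¹≈ε⇒x≈y (ℕ→ℚ k) 1ℚ eq)))

-- The eleven resistances

module Resistances (m n p : ℕ) (1≤m : 1 ≤ m) (1≤n : 1 ≤ n) (p≤m : p ≤ m) (p≤n : p ≤ n)
  (con : Connected (Gmnp m n p)) where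

  private
    G = Gmnp m n p
    M N P D Dp : ℚ
    M = ℕ→ℚ m
    N = ℕ→ℚ n
    P = ℕ→ℚ p
    D = M * N - M - N
    Dp = D + P
    mnD : Set
    mnD = m ℕ.* n ≢ m ℕ.+ n

  M≢0 : M ≢ 0ℚ
  M≢0 = ℕ→ℚ-≢0 1≤m

  N≢0 : N ≢ 0ℚ
  N≢0 = ℕ→ℚ-≢0 1≤n

  -- For positive `m` and `n` the equation `m n = m + n` reads `(m - 1)(n - 1) = 1`, so `mnD`
  -- excludes exactly `m = n = 2`.
  D≢0 : mnD → D ≢ 0ℚ
  D≢0 mn eq = mn (ℕ→ℚ-injective (trans (ℕ→ℚ-* m n) (trans
    (x∙y⁻¹≈ε⇒x≈y (M * N) (M + N) (trans (regroup M N) eq)) (sym (ℕ→ℚ-+ m n)))))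
    where
    regroup : ∀ M N → M * N - (M + N) ≡ M * N - M - N
    regroup = solve-∀ ℚ-ring

  -- For `p = 0` this is the previous fact. For `p > 0` connectedness forces `m` and `n` to be at
  -- least 2, so `m n` is at least `m + n` and adding `p` makes the inequality strict.
  Dp≢0 : mnD → Dp ≢ 0ℚ
  Dp≢0 mn eq = impossible (ℕ→ℚ-injective (begin
    ℕ→ℚ (m ℕ.* n ℕ.+ p)          ≡⟨ ℕ→ℚ-+ (m ℕ.* n) p ⟩
    ℕ→ℚ (m ℕ.* n) + P            ≡⟨ cong (_+ P) (ℕ→ℚ-* m n) ⟩
    M * N + P                    ≡⟨ x∙y⁻¹≈ε⇒x≈y (M * N + P) (M + N) (trans (regroup M N P) eq) ⟩
    M + N                        ≡⟨ ℕ→ℚ-+ m n ⟨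
    ℕ→ℚ (m ℕ.+ n)                ∎))
    where
    open ≡-Reasoning
    regroup : ∀ M N P → M * N + P - (M + N) ≡ M * N - M - N + P
    regroup = solve-∀ ℚ-ring
    impossible : m ℕ.* n ℕ.+ p ≢ m ℕ.+ n
    impossible e with p ℕP.≟ 0
    ... | yes p≡0 = mn (trans (sym (trans (cong (m ℕ.* n ℕ.+_) p≡0) (ℕP.+-identityʳ (m ℕ.* n)))) e)
    ... | no p≢0 = ℕP.<-irrefl (sym e) (ℕP.≤-<-trans
        (m+n≤m*n (connected⇒2≤m 0<p p≤m p≤n con) (connected⇒2≤n 0<p p≤m p≤n con)) (ℕP.m<m+n (m ℕ.* n) 0<p))
      where
      0<p : 0 < p
      0<p = ℕP.n≢0⇒n>0 p≢0

  module _ {k} (k<p : k < p) where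

    private
      0<p : 0 < p
      0<p = ℕP.≤-<-trans z≤n k<p

    P≢0 : P ≢ 0ℚ
    P≢0 = ℕ→ℚ-≢0 0<p

    M-1≢0 : M - 1ℚ ≢ 0ℚ
    M-1≢0 = ℕ→ℚ-1≢0 (connected⇒2≤m 0<p p≤m p≤n con)

    N-1≢0 : N - 1ℚ ≢ 0ℚ
    N-1≢0 = ℕ→ℚ-1≢0 (connected⇒2≤n 0<p p≤m p≤n con)

  xv-≢ : ∀ {i j : Fin m} → i ≢ j → xv n i ≢ xv n j
  xv-≢ {i} {j} i≢j = i≢j ∘ ↑ˡ-injective n i j

  yv-≢ : ∀ {i j : Fin n} → i ≢ j → yv m i ≢ yv m j
  yv-≢ {i} {j} i≢j = i≢j ∘ ↑ʳ-injective m i j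

  split-≢ : ∀ {k l} → k < p → p ≤ l → k ≢ l
  split-≢ k<p p≤l refl = ℕP.<⇒≱ k<p p≤l

  toℕ-≢ : ∀ {k} {i j : Fin k} → i ≢ j → toℕ i ≢ toℕ j
  toℕ-≢ i≢j = i≢j ∘ toℕ-injective

  private
    module F = Flow m n p p≤m p≤n

    nonzero : ∀ {e d d′} → e ≢ 0ℚ → mnD → d ≢ 0ℚ → d′ ≢ 0ℚ → e * (Dp * N * d * d′) ≢ 0ℚ
    nonzero e≢0 mn d≢0 d′≢0 = *-≢0 e≢0 (*-≢0 (*-≢0 (*-≢0 (Dp≢0 mn) N≢0) d≢0) d′≢0)

    1≢0 : 1ℚ ≢ 0ℚ
    1≢0 ()

    self : ∀ k → ind (k ℕ.≡ᵇ k) ≡ 1ℚ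
    self k = ind-same {k} refl

  R-x<x< : (i j : Fin m) → i ≢ j → toℕ i < p → toℕ j < p → mnD →
           ResistanceIs G (xv n i) (xv n j) (((1ℚ + 1ℚ) * (M - 1ℚ)) ÷ D)
  R-x<x< i j i≢j i<p j<p mn = drop⇒resistance G con (xv-≢ i≢j) λ g c lap →
    let open F (inj₁ i) (inj₁ j) g c lap using (atX<; atW) in
    drop-formula 1ℚ _
      (atX< i i<p (cong₂ _-_ (self (toℕ i)) (ind-diff (toℕ-≢ i≢j))) refl)
      (atX< j j<p (cong₂ _-_ (ind-diff (toℕ-≢ (i≢j ∘ sym))) (self (toℕ j))) refl)
      (atW (sumTo-ind-< (toℕ<n i)) (sumTo-ind-< i<p) (sumTo-0 p)
           (sumTo-ind-< (toℕ<n j)) (sumTo-ind-< j<p) (sumTo-0 p))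
      (nonzero 1≢0 mn (D≢0 mn) (D≢0 mn))
      (clear-<< M N P (M - 1ℚ) (- 1ℚ) (D≢0 mn))

  R-x≥x≥ : (i j : Fin m) → i ≢ j → p ≤ toℕ i → p ≤ toℕ j →
           ResistanceIs G (xv n i) (xv n j) ((1ℚ + 1ℚ) ÷ N)
  R-x≥x≥ i j i≢j p≤i p≤j = drop⇒resistance G con (xv-≢ i≢j) λ g c lap →
    let open F (inj₁ i) (inj₁ j) g c lap using (rowX≥) in
    subst₂ (λ x y → x - y ≡ c * ((1ℚ + 1ℚ) ÷ N)) (gX-toℕ m n p g i) (gX-toℕ m n p g j)
      (half-drop {c = c} N≢0
        (trans (rowX≥ p≤i (toℕ<n i)) (cong (c *_) (cong₂ _-_ (self (toℕ i)) (ind-diff (toℕ-≢ i≢j)))))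
        (trans (rowX≥ p≤j (toℕ<n j)) (cong (c *_) (cong₂ _-_ (ind-diff (toℕ-≢ (i≢j ∘ sym))) (self (toℕ j))))))

  R-x<x≥ : (i j : Fin m) → toℕ i < p → p ≤ toℕ j → mnD →
           ResistanceIs G (xv n i) (xv n j)
             ((((1ℚ + 1ℚ) * N - 1ℚ) ÷ (N * (N - 1ℚ)))
              + ((P - 1ℚ) ÷ (P * (N - 1ℚ) * D))
              + ((N - P) ÷ (P * N * (N - 1ℚ) * Dp)))
  R-x<x≥ i j i<p p≤j mn = drop⇒resistance G con (xv-≢ (split-≢ i<p p≤j ∘ cong toℕ)) λ g c lap →
    let open F (inj₁ i) (inj₁ j) g c lap using (atX<; atX≥; atW) in
    drop-formula (P * (N - 1ℚ)) _
      (atX< i i<p (cong₂ _-_ (self (toℕ i)) (ind-diff (split-≢ i<p p≤j))) refl)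
      (atX≥ j p≤j (cong₂ _-_ (ind-diff (split-≢ i<p p≤j ∘ sym)) (self (toℕ j))))
      (atW (sumTo-ind-< (toℕ<n i)) (sumTo-ind-< i<p) (sumTo-0 p)
           (sumTo-ind-< (toℕ<n j)) (sumTo-ind-≥ p≤j) (sumTo-0 p))
      (nonzero (*-≢0 (P≢0 i<p) (N-1≢0 i<p)) mn (D≢0 mn) N≢0)
      (clear-X<X≥ M N P (*-≢0 N≢0 (N-1≢0 i<p)) (*-≢0 (*-≢0 (P≢0 i<p) (N-1≢0 i<p)) (D≢0 mn))
        (*-≢0 (*-≢0 (*-≢0 (P≢0 i<p) N≢0) (N-1≢0 i<p)) (Dp≢0 mn)))

  R-y<y< : (i j : Fin n) → i ≢ j → toℕ i < p → toℕ j < p → mnD →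
           ResistanceIs G (yv m i) (yv m j) (((1ℚ + 1ℚ) * (N - 1ℚ)) ÷ D)
  R-y<y< i j i≢j i<p j<p mn = drop⇒resistance G con (yv-≢ i≢j) λ g c lap →
    let open F (inj₂ i) (inj₂ j) g c lap using (atY<; atW) in
    drop-formula 1ℚ _
      (atY< i i<p refl (cong₂ _-_ (self (toℕ i)) (ind-diff (toℕ-≢ i≢j))))
      (atY< j j<p refl (cong₂ _-_ (ind-diff (toℕ-≢ (i≢j ∘ sym))) (self (toℕ j))))
      (atW (sumTo-0 m) (sumTo-0 p) (sumTo-ind-< i<p)
           (sumTo-0 m) (sumTo-0 p) (sumTo-ind-< j<p))
      (nonzero 1≢0 mn (D≢0 mn) (D≢0 mn))
      (clear-<< M N P (N - 1ℚ) (N - 1ℚ) (D≢0 mn))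

  R-y≥y≥ : (i j : Fin n) → i ≢ j → p ≤ toℕ i → p ≤ toℕ j →
           ResistanceIs G (yv m i) (yv m j) ((1ℚ + 1ℚ) ÷ M)
  R-y≥y≥ i j i≢j p≤i p≤j = drop⇒resistance G con (yv-≢ i≢j) λ g c lap →
    let open F (inj₂ i) (inj₂ j) g c lap using (rowY≥) in
    subst₂ (λ x y → x - y ≡ c * ((1ℚ + 1ℚ) ÷ M)) (gY-toℕ m n p g i) (gY-toℕ m n p g j)
      (half-drop {c = c} M≢0
        (trans (rowY≥ p≤i (toℕ<n i)) (cong (c *_) (cong₂ _-_ (self (toℕ i)) (ind-diff (toℕ-≢ i≢j)))))
        (trans (rowY≥ p≤j (toℕ<n j)) (cong (c *_) (cong₂ _-_ (ind-diff (toℕ-≢ (i≢j ∘ sym))) (self (toℕ j))))))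

  R-y<y≥ : (i j : Fin n) → toℕ i < p → p ≤ toℕ j → mnD →
           ResistanceIs G (yv m i) (yv m j)
             ((((1ℚ + 1ℚ) * M - 1ℚ) ÷ (M * (M - 1ℚ)))
              + ((P - 1ℚ) ÷ (P * (M - 1ℚ) * D))
              + ((M - P) ÷ (P * M * (M - 1ℚ) * Dp)))
  R-y<y≥ i j i<p p≤j mn = drop⇒resistance G con (yv-≢ (split-≢ i<p p≤j ∘ cong toℕ)) λ g c lap →
    let open F (inj₂ i) (inj₂ j) g c lap using (atY<; atY≥; atW) in
    drop-formula (P * (M - 1ℚ)) _
      (atY< i i<p refl (cong₂ _-_ (self (toℕ i)) (ind-diff (split-≢ i<p p≤j))))
      (atY≥ j p≤j (cong₂ _-_ (ind-diff (split-≢ i<p p≤j ∘ sym)) (self (toℕ j))))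
      (atW (sumTo-0 m) (sumTo-0 p) (sumTo-ind-< i<p)
           (sumTo-0 m) (sumTo-0 p) (sumTo-ind-≥ p≤j))
      (nonzero (*-≢0 (P≢0 i<p) (M-1≢0 i<p)) mn (D≢0 mn) M≢0)
      (clear-Y<Y≥ M N P (*-≢0 M≢0 (M-1≢0 i<p)) (*-≢0 (*-≢0 (P≢0 i<p) (M-1≢0 i<p)) (D≢0 mn))
        (*-≢0 (*-≢0 (*-≢0 (P≢0 i<p) M≢0) (M-1≢0 i<p)) (Dp≢0 mn)))

  R-x<y<-equal : (i : Fin m) (j : Fin n) → toℕ i ≡ toℕ j → toℕ i < p → mnD →
                 ResistanceIs G (xv n i) (yv m j) (((M + N) ÷ D) - ((M * N) ÷ (D * Dp)))
  R-x<y<-equal i j i≡j i<p mn = drop⇒resistance G con (xv≢yv i j) λ g c lap →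
    let open F (inj₁ i) (inj₂ j) g c lap using (atX<; atY<; atW)
        j<p = subst (_< p) i≡j i<p in
    drop-formula 1ℚ _
      (atX< i i<p (cong (_- 0ℚ) (self (toℕ i))) (cong (λ s → 0ℚ - s) (ind-same i≡j)))
      (atY< j j<p (cong (_- 0ℚ) (ind-same (sym i≡j))) (cong (λ s → 0ℚ - s) (self (toℕ j))))
      (atW (sumTo-ind-< (toℕ<n i)) (sumTo-ind-< i<p) (sumTo-0 p)
           (sumTo-0 m) (sumTo-0 p) (sumTo-ind-< j<p))
      (nonzero 1≢0 mn (D≢0 mn) (D≢0 mn))
      (clear-X<Y< M N P {f = 1ℚ} (D≢0 mn) (*-≢0 (D≢0 mn) (Dp≢0 mn)) (total M N))
    where
    total : ∀ M N → (M - 1ℚ) * 1ℚ + (N - 1ℚ) + (1ℚ + 1ℚ) * 1ℚ ≡ M + N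
    total = solve-∀ ℚ-ring

  R-x<y<-different : (i : Fin m) (j : Fin n) → toℕ i ≢ toℕ j → toℕ i < p → toℕ j < p → mnD →
                     ResistanceIs G (xv n i) (yv m j) (((M + N - (1ℚ + 1ℚ)) ÷ D) - ((M * N) ÷ (D * Dp)))
  R-x<y<-different i j i≢j i<p j<p mn = drop⇒resistance G con (xv≢yv i j) λ g c lap →
    let open F (inj₁ i) (inj₂ j) g c lap using (atX<; atY<; atW) in
    drop-formula 1ℚ _
      (atX< i i<p (cong (_- 0ℚ) (self (toℕ i))) (cong (λ s → 0ℚ - s) (ind-diff i≢j)))
      (atY< j j<p (cong (_- 0ℚ) (ind-diff (i≢j ∘ sym))) (cong (λ s → 0ℚ - s) (self (toℕ j))))
      (atW (sumTo-ind-< (toℕ<n i)) (sumTo-ind-< i<p) (sumTo-0 p)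
           (sumTo-0 m) (sumTo-0 p) (sumTo-ind-< j<p))
      (nonzero 1≢0 mn (D≢0 mn) (D≢0 mn))
      (clear-X<Y< M N P {f = 0ℚ} (D≢0 mn) (*-≢0 (D≢0 mn) (Dp≢0 mn)) (total M N))
    where
    total : ∀ M N → (M - 1ℚ) * 1ℚ + (N - 1ℚ) + (1ℚ + 1ℚ) * 0ℚ ≡ M + N - (1ℚ + 1ℚ)
    total = solve-∀ ℚ-ring

  R-x<y≥ : (i : Fin m) (j : Fin n) → toℕ i < p → p ≤ toℕ j → mnD →
           ResistanceIs G (xv n i) (yv m j)
             ((1ℚ ÷ M) + (((P - 1ℚ) * (M - 1ℚ)) ÷ (P * D)) + (((M - P) * (M - 1ℚ)) ÷ (P * M * Dp)))
  R-x<y≥ i j i<p p≤j mn = drop⇒resistance G con (xv≢yv i j) λ g c lap →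
    let open F (inj₁ i) (inj₂ j) g c lap using (atX<; atY≥; atW) in
    drop-formula P _
      (atX< i i<p (cong (_- 0ℚ) (self (toℕ i))) (cong (λ s → 0ℚ - s) (ind-diff (split-≢ i<p p≤j))))
      (atY≥ j p≤j (cong (λ s → 0ℚ - s) (self (toℕ j))))
      (atW (sumTo-ind-< (toℕ<n i)) (sumTo-ind-< i<p) (sumTo-0 p)
           (sumTo-0 m) (sumTo-0 p) (sumTo-ind-≥ p≤j))
      (nonzero (P≢0 i<p) mn (D≢0 mn) M≢0)
      (clear-X<Y≥ M N P M≢0 (*-≢0 (P≢0 i<p) (D≢0 mn)) (*-≢0 (*-≢0 (P≢0 i<p) M≢0) (Dp≢0 mn)))

  R-x≥y< : (i : Fin m) (j : Fin n) → p ≤ toℕ i → toℕ j < p → mnD →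
           ResistanceIs G (xv n i) (yv m j)
             ((1ℚ ÷ N) + (((P - 1ℚ) * (N - 1ℚ)) ÷ (P * D)) + (((N - P) * (N - 1ℚ)) ÷ (P * N * Dp)))
  R-x≥y< i j p≤i j<p mn = drop⇒resistance G con (xv≢yv i j) λ g c lap →
    let open F (inj₁ i) (inj₂ j) g c lap using (atY<; atX≥; atW) in
    drop-formula P _
      (atX≥ i p≤i (cong (_- 0ℚ) (self (toℕ i))))
      (atY< j j<p (cong (_- 0ℚ) (ind-diff (split-≢ j<p p≤i))) (cong (λ s → 0ℚ - s) (self (toℕ j))))
      (atW (sumTo-ind-< (toℕ<n i)) (sumTo-ind-≥ p≤i) (sumTo-0 p)
           (sumTo-0 m) (sumTo-0 p) (sumTo-ind-< j<p))
      (nonzero (P≢0 j<p) mn N≢0 (D≢0 mn))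
      (clear-X≥Y< M N P N≢0 (*-≢0 (P≢0 j<p) (D≢0 mn)) (*-≢0 (*-≢0 (P≢0 j<p) N≢0) (Dp≢0 mn)))

  R-x≥y≥ : (i : Fin m) (j : Fin n) → p ≤ toℕ i → p ≤ toℕ j → mnD →
           ResistanceIs G (xv n i) (yv m j) ((1ℚ ÷ M) + (1ℚ ÷ N) - (D ÷ (M * N * Dp)))
  R-x≥y≥ i j p≤i p≤j mn = drop⇒resistance G con (xv≢yv i j) λ g c lap →
    let open F (inj₁ i) (inj₂ j) g c lap using (atX≥; atY≥; atW) in
    drop-formula 1ℚ _
      (atX≥ i p≤i (cong (_- 0ℚ) (self (toℕ i))))
      (atY≥ j p≤j (cong (λ s → 0ℚ - s) (self (toℕ j))))
      (atW (sumTo-ind-< (toℕ<n i)) (sumTo-ind-≥ p≤i) (sumTo-0 p)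
           (sumTo-0 m) (sumTo-0 p) (sumTo-ind-≥ p≤j))
      (nonzero 1≢0 mn N≢0 M≢0)
      (clear-X≥Y≥ M N P M≢0 N≢0 (*-≢0 (*-≢0 M≢0 N≢0) (Dp≢0 mn)))

theorem5p7 : (m n p : ℕ) → 1 ≤ m → 1 ≤ n → p ≤ m → p ≤ n →
  Connected (Gmnp m n p) →
  let G = Gmnp m n p
      M = ℕ→ℚ m
      N = ℕ→ℚ n
      P = ℕ→ℚ p
      one = ℕ→ℚ 1
      two = ℕ→ℚ 2
      D = M * N - M - N
      Dp = D + P
      mnD = m ℕ.* n ≢ m ℕ.+ n
  in
  -- (1) R_{x_i x_j}
  ((i j : Fin m) → i ≢ j → toℕ i < p → toℕ j < p → mnD →
    ResistanceIs G (xv n i) (xv n j) ((two * (M - one)) ÷ D)) ×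
  ((i j : Fin m) → i ≢ j → p ≤ toℕ i → p ≤ toℕ j →
    ResistanceIs G (xv n i) (xv n j) (two ÷ N)) ×
  ((i j : Fin m) → toℕ i < p → p ≤ toℕ j → mnD →
    ResistanceIs G (xv n i) (xv n j)
      (((two * N - one) ÷ (N * (N - one)))
       + ((P - one) ÷ (P * (N - one) * D))
       + ((N - P) ÷ (P * N * (N - one) * Dp)))) ×
  -- (2) R_{y_i y_j}
  ((i j : Fin n) → i ≢ j → toℕ i < p → toℕ j < p → mnD →
    ResistanceIs G (yv m i) (yv m j) ((two * (N - one)) ÷ D)) ×
  ((i j : Fin n) → i ≢ j → p ≤ toℕ i → p ≤ toℕ j →
    ResistanceIs G (yv m i) (yv m j) (two ÷ M)) ×
  ((i j : Fin n) → toℕ i < p → p ≤ toℕ j → mnD →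
    ResistanceIs G (yv m i) (yv m j)
      (((two * M - one) ÷ (M * (M - one)))
       + ((P - one) ÷ (P * (M - one) * D))
       + ((M - P) ÷ (P * M * (M - one) * Dp)))) ×
  -- (3) R_{x_i y_j}
  ((i : Fin m) (j : Fin n) → toℕ i ≡ toℕ j → toℕ i < p → mnD →
    ResistanceIs G (xv n i) (yv m j)
      (((M + N) ÷ D) - ((M * N) ÷ (D * Dp)))) ×
  ((i : Fin m) (j : Fin n) → toℕ i ≢ toℕ j → toℕ i < p → toℕ j < p → mnD →
    ResistanceIs G (xv n i) (yv m j)
      (((M + N - two) ÷ D) - ((M * N) ÷ (D * Dp)))) ×
  ((i : Fin m) (j : Fin n) → toℕ i < p → p ≤ toℕ j → mnD →
    ResistanceIs G (xv n i) (yv m j)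
      ((one ÷ M) + (((P - one) * (M - one)) ÷ (P * D))
       + (((M - P) * (M - one)) ÷ (P * M * Dp)))) ×
  ((i : Fin m) (j : Fin n) → p ≤ toℕ i → toℕ j < p → mnD →
    ResistanceIs G (xv n i) (yv m j)
      ((one ÷ N) + (((P - one) * (N - one)) ÷ (P * D))
       + (((N - P) * (N - one)) ÷ (P * N * Dp)))) ×
  ((i : Fin m) (j : Fin n) → p ≤ toℕ i → p ≤ toℕ j → mnD →
    ResistanceIs G (xv n i) (yv m j)
      ((one ÷ M) + (one ÷ N) - (D ÷ (M * N * Dp))))
theorem5p7 m n p 1≤m 1≤n p≤m p≤n con =
  R-x<x< , R-x≥x≥ , R-x<x≥ , R-y<y< , R-y≥y≥ , R-y<y≥ ,
  R-x<y<-equal , R-x<y<-different , R-x<y≥ , R-x≥y< , R-x≥y≥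
  where open Resistances m n p 1≤m 1≤n p≤m p≤n con
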